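{- Let $m \geq 3$ be a fixed integer. Then for all sufficiently large positive integers $k$ (i.e., for all $k \ge k_0$, where $k_0$ may depend on $m$), \[ w(k,m) > k^{\,m-1-\frac{1}{\log \log k}} . \]
   Context: For positive integers $k$ and $m$, $w(k,m)$ denotes the least positive integer $n$ such that every 2-coloring of $[1,n]=\{1,2,\dots,n\}$ admits either a $k$-term arithmetic progression all of whose elements have the first color, or an $m$-term arithmetic progression all of whose elements have the second color. Such an $n$ exists by van der Waerden's theorem. Here $\log$ is the natural logarithm. -}

module Defs where

open import Algebra.Definitions.RawSemiring using ()
open import Data.Bool.Base using (Bool; true; false)
open import Data.Fin.Base using (Fin; toℕ)
open import Data.Integer.Base as ℤ using (+_)
import Data.Integer.Properties as ℤ
open import Data.Nat.Base as ℕ using (ℕ; zero; suc; _!)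
import Data.Nat.Properties as ℕ
open import Data.Product.Base using (_×_; _,_; ∃; ∃-syntax; proj₁; proj₂)
open import Data.Rational.Base as ℚ using (ℚ; 0ℚ; 1ℚ; ½; ∣_∣; _/_; mkℚ)
open import Data.Rational.Properties as ℚ using (module ≤-Reasoning)
open import Data.Rational.Solver using (module +-*-Solver)
import Data.Rational.Unnormalised.Base as ℚᵘ
import Data.Rational.Unnormalised.Properties as ℚᵘ
open import Data.Sum.Base using (_⊎_; inj₁; inj₂)
open import Relation.Binary.PropositionalEquality
  using (_≡_; refl; sym; trans; cong; cong₂; subst; subst₂)

open Algebra.Definitions.RawSemiring ℚ.+-*-rawSemiring using (_^_)

------------------------------------------------------------------------
-- Van der Waerden numbers

-- The element x of Fin n stands for the integer 1 + toℕ x, so that Fin n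
-- is the interval [1, n].

Coloring : ℕ → Set
Coloring n = Fin n → Bool

-- Some progression a, a + d, …, a + (ℓ - 1) d with d ≥ 1 lies in [1, n] and
-- all its terms have colour b.

HasMonoAP : ∀ {n} → Coloring n → Bool → ℕ → Set
HasMonoAP {n} χ b ℓ = ∃[ a ] ∃[ d ] 1 ℕ.≤ d × (∀ (i : Fin ℓ) →
  ∃[ x ] suc (toℕ {n} x) ≡ a ℕ.+ toℕ i ℕ.* d × χ x ≡ b)

Unavoidable : ℕ → ℕ → ℕ → Set
Unavoidable k m n = ∀ (χ : Coloring n) → HasMonoAP χ true k ⊎ HasMonoAP χ false m

-- "w(k, m) = n".

IsVdW : ℕ → ℕ → ℕ → Set
IsVdW k m n = 1 ℕ.≤ n × Unavoidable k m n ×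
  (∀ n′ → 1 ℕ.≤ n′ → Unavoidable k m n′ → n ℕ.≤ n′)

------------------------------------------------------------------------
-- Real numbers as Cauchy sequences of rationals

IsCauchy : (ℕ → ℚ) → Set
IsCauchy u = ∀ ε → 0ℚ ℚ.< ε → ∃[ N ] (∀ i j → N ℕ.≤ i → N ℕ.≤ j → ∣ u i ℚ.- u j ∣ ℚ.< ε)

record ℝ : Set where
  constructor real
  field
    seq    : ℕ → ℚ
    cauchy : IsCauchy seq

open ℝ public

infix 4 _≃_ _<_

_≃_ : ℝ → ℝ → Set
x ≃ y = ∀ ε → 0ℚ ℚ.< ε → ∃[ N ] (∀ i → N ℕ.≤ i → ∣ seq x i ℚ.- seq y i ∣ ℚ.< ε)

_<_ : ℝ → ℝ → Set
x < y = ∃[ ε ] 0ℚ ℚ.< ε × ∃[ N ] (∀ i → N ℕ.≤ i → seq x i ℚ.+ ε ℚ.< seq y i)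

fromℚ : ℚ → ℝ
fromℚ q = real (λ _ → q) λ ε 0<ε → 0 , λ _ _ _ _ →
  subst (ℚ._< ε) (sym (cong ∣_∣ (ℚ.+-inverseʳ q))) 0<ε

fromℕ : ℕ → ℝ
fromℕ n = fromℚ (+ n / 1)

1ℝ : ℝ
1ℝ = fromℕ 1

module RationalLemmas where

  half : ℚ → ℚ
  half ε = ½ ℚ.* ε

  half-pos : ∀ {ε} → 0ℚ ℚ.< ε → 0ℚ ℚ.< half ε
  half-pos {ε} 0<ε = subst (ℚ._< half ε) (ℚ.*-zeroʳ ½) (ℚ.*-monoʳ-<-pos ½ 0<ε)

  half+half : ∀ ε → half ε ℚ.+ half ε ≡ ε
  half+half ε = trans (sym (ℚ.*-distribʳ-+ ε ½ ½)) (ℚ.*-identityˡ ε)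

  *-mono-≤ : ∀ {p q r s} → 0ℚ ℚ.≤ p → p ℚ.≤ q → 0ℚ ℚ.≤ r → r ℚ.≤ s → p ℚ.* r ℚ.≤ q ℚ.* s
  *-mono-≤ {p} {q} {r} {s} 0≤p p≤q 0≤r r≤s = ℚ.≤-trans
    (ℚ.*-monoʳ-≤-nonNeg r {{ℚ.nonNegative 0≤r}} p≤q)
    (ℚ.*-monoˡ-≤-nonNeg q {{ℚ.nonNegative (ℚ.≤-trans 0≤p p≤q)}} r≤s)

  *-pos : ∀ {p q} → 0ℚ ℚ.< p → 0ℚ ℚ.< q → 0ℚ ℚ.< p ℚ.* q
  *-pos {p} {q} 0<p 0<q = ℚ.positive⁻¹ (p ℚ.* q)
    {{ℚ.pos*pos⇒pos p {{ℚ.positive 0<p}} q {{ℚ.positive 0<q}}}}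

  *-nonNeg : ∀ {p q} → 0ℚ ℚ.≤ p → 0ℚ ℚ.≤ q → 0ℚ ℚ.≤ p ℚ.* q
  *-nonNeg {p} {q} 0≤p 0≤q = ℚ.nonNegative⁻¹ (p ℚ.* q)
    {{ℚ.nonNeg*nonNeg⇒nonNeg p {{ℚ.nonNegative 0≤p}} q {{ℚ.nonNegative 0≤q}}}}

  +-nonNeg : ∀ {p q} → 0ℚ ℚ.≤ p → 0ℚ ℚ.≤ q → 0ℚ ℚ.≤ p ℚ.+ q
  +-nonNeg 0≤p 0≤q = ℚ.+-mono-≤ 0≤p 0≤q

  p≤p+q : ∀ p {q} → 0ℚ ℚ.≤ q → p ℚ.≤ p ℚ.+ q
  p≤p+q p {q} 0≤q = subst (ℚ._≤ p ℚ.+ q) (ℚ.+-identityʳ p) (ℚ.+-monoʳ-≤ p {0ℚ} 0≤q)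

  scale : ∀ K ε → 0ℚ ℚ.≤ K → 0ℚ ℚ.< ε → ∃[ δ ] 0ℚ ℚ.< δ × K ℚ.* δ ℚ.< ε
  scale K ε 0≤K 0<ε = δ , 0<δ , (begin-strict
      K ℚ.* δ              <⟨ ℚ.*-monoˡ-<-pos δ {{ℚ.positive 0<δ}} K<K′ ⟩
      K′ ℚ.* δ             ≡⟨ sym (ℚ.*-assoc K′ (ℚ.1/ K′) ε) ⟩
      K′ ℚ.* ℚ.1/ K′ ℚ.* ε ≡⟨ cong (ℚ._* ε) (ℚ.*-inverseʳ K′) ⟩
      1ℚ ℚ.* ε             ≡⟨ ℚ.*-identityˡ ε ⟩
      ε                    ∎)
    where
    open ≤-Reasoning
    K′ = K ℚ.+ 1ℚ
    K<K′ : K ℚ.< K′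
    K<K′ = subst (ℚ._< K′) (ℚ.+-identityʳ K) (ℚ.+-monoʳ-< K (ℚ.positive⁻¹ 1ℚ))
    instance
      K′-pos : ℚ.Positive K′
      K′-pos = ℚ.positive (ℚ.≤-<-trans 0≤K K<K′)
      K′-nz : ℚ.NonZero K′
      K′-nz = ℚ.pos⇒nonZero K′
    δ = ℚ.1/ K′ ℚ.* ε
    0<δ : 0ℚ ℚ.< δ
    0<δ = *-pos (ℚ.positive⁻¹ (ℚ.1/ K′) {{ℚ.1/pos⇒pos K′}}) 0<ε

  bounded : ∀ x → ∃[ B ] 0ℚ ℚ.≤ B × ∃[ N ] (∀ i → N ℕ.≤ i → ∣ seq x i ∣ ℚ.≤ B)
  bounded x with cauchy x 1ℚ (ℚ.positive⁻¹ 1ℚ)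
  ... | N , close =
      ∣ seq x N ∣ ℚ.+ 1ℚ
    , +-nonNeg (ℚ.0≤∣p∣ (seq x N)) (ℚ.nonNegative⁻¹ 1ℚ)
    , N
    , λ i N≤i → begin
        ∣ seq x i ∣                                  ≡⟨ cong ∣_∣ (split (seq x i) (seq x N)) ⟩
        ∣ seq x N ℚ.+ (seq x i ℚ.- seq x N) ∣        ≤⟨ ℚ.∣p+q∣≤∣p∣+∣q∣ (seq x N) (seq x i ℚ.- seq x N) ⟩
        ∣ seq x N ∣ ℚ.+ ∣ seq x i ℚ.- seq x N ∣      ≤⟨ ℚ.+-monoʳ-≤ ∣ seq x N ∣ (ℚ.<⇒≤ (close i N N≤i ℕ.≤-refl)) ⟩
        ∣ seq x N ∣ ℚ.+ 1ℚ                           ∎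
    where
    open ≤-Reasoning
    open +-*-Solver
    split : ∀ p q → p ≡ q ℚ.+ (p ℚ.- q)
    split = solve 2 (λ p q → p := q :+ (p :- q)) refl

  product-diff : ∀ a b c d A B → ∣ a ∣ ℚ.≤ A → ∣ d ∣ ℚ.≤ B →
    ∣ a ℚ.* b ℚ.- c ℚ.* d ∣ ℚ.≤ A ℚ.* ∣ b ℚ.- d ∣ ℚ.+ B ℚ.* ∣ a ℚ.- c ∣
  product-diff a b c d A B a≤A d≤B = begin
    ∣ a ℚ.* b ℚ.- c ℚ.* d ∣                                 ≡⟨ cong ∣_∣ (split a b c d) ⟩
    ∣ a ℚ.* (b ℚ.- d) ℚ.+ d ℚ.* (a ℚ.- c) ∣                 ≤⟨ ℚ.∣p+q∣≤∣p∣+∣q∣ (a ℚ.* (b ℚ.- d)) (d ℚ.* (a ℚ.- c)) ⟩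
    ∣ a ℚ.* (b ℚ.- d) ∣ ℚ.+ ∣ d ℚ.* (a ℚ.- c) ∣             ≡⟨ cong₂ ℚ._+_ (ℚ.∣p*q∣≡∣p∣*∣q∣ a (b ℚ.- d)) (ℚ.∣p*q∣≡∣p∣*∣q∣ d (a ℚ.- c)) ⟩
    ∣ a ∣ ℚ.* ∣ b ℚ.- d ∣ ℚ.+ ∣ d ∣ ℚ.* ∣ a ℚ.- c ∣         ≤⟨ ℚ.+-mono-≤
                                                                 (*-mono-≤ (ℚ.0≤∣p∣ a) a≤A (ℚ.0≤∣p∣ (b ℚ.- d)) ℚ.≤-refl)
                                                                 (*-mono-≤ (ℚ.0≤∣p∣ d) d≤B (ℚ.0≤∣p∣ (a ℚ.- c)) ℚ.≤-refl) ⟩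
    A ℚ.* ∣ b ℚ.- d ∣ ℚ.+ B ℚ.* ∣ a ℚ.- c ∣                 ∎
    where
    open ≤-Reasoning
    open +-*-Solver
    split : ∀ a b c d → a ℚ.* b ℚ.- c ℚ.* d ≡ a ℚ.* (b ℚ.- d) ℚ.+ d ℚ.* (a ℚ.- c)
    split = solve 4 (λ a b c d → a :* b :- c :* d := a :* (b :- d) :+ d :* (a :- c)) refl

open RationalLemmas

infix  8 -_
infixl 7 _*_
infixl 6 _+_ _-_

_+_ : ℝ → ℝ → ℝ
x + y = real (λ i → seq x i ℚ.+ seq y i) λ ε 0<ε →
  let N , x-close = cauchy x (half ε) (half-pos 0<ε)
      M , y-close = cauchy y (half ε) (half-pos 0<ε)
  in N ℕ.⊔ M , λ i j ≤i ≤j → begin-strict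
    ∣ (seq x i ℚ.+ seq y i) ℚ.- (seq x j ℚ.+ seq y j) ∣    ≡⟨ cong ∣_∣ (split (seq x i) (seq y i) (seq x j) (seq y j)) ⟩
    ∣ (seq x i ℚ.- seq x j) ℚ.+ (seq y i ℚ.- seq y j) ∣    ≤⟨ ℚ.∣p+q∣≤∣p∣+∣q∣ (seq x i ℚ.- seq x j) (seq y i ℚ.- seq y j) ⟩
    ∣ seq x i ℚ.- seq x j ∣ ℚ.+ ∣ seq y i ℚ.- seq y j ∣    <⟨ ℚ.+-mono-<
        (x-close i j (ℕ.m⊔n≤o⇒m≤o N M ≤i) (ℕ.m⊔n≤o⇒m≤o N M ≤j))
        (y-close i j (ℕ.m⊔n≤o⇒n≤o N M ≤i) (ℕ.m⊔n≤o⇒n≤o N M ≤j)) ⟩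
    half ε ℚ.+ half ε                                      ≡⟨ half+half ε ⟩
    ε                                                      ∎
  where
  open ≤-Reasoning
  open +-*-Solver
  split : ∀ a b c d → (a ℚ.+ b) ℚ.- (c ℚ.+ d) ≡ (a ℚ.- c) ℚ.+ (b ℚ.- d)
  split = solve 4 (λ a b c d → (a :+ b) :- (c :+ d) := (a :- c) :+ (b :- d)) refl

-_ : ℝ → ℝ
- x = real (λ i → ℚ.- seq x i) λ ε 0<ε →
  let N , close = cauchy x ε 0<ε
  in N , λ i j ≤i ≤j → subst (ℚ._< ε)
       (trans (sym (ℚ.∣-p∣≡∣p∣ (seq x i ℚ.- seq x j)))
              (cong ∣_∣ (ℚ.neg-distrib-+ (seq x i) (ℚ.- seq x j))))
       (close i j ≤i ≤j)

_-_ : ℝ → ℝ → ℝ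
x - y = x + (- y)

_*_ : ℝ → ℝ → ℝ
x * y = real (λ i → seq x i ℚ.* seq y i) λ ε 0<ε →
  let A , 0≤A , N₁ , x≤A = bounded x
      B , 0≤B , N₂ , y≤B = bounded y
      δ , 0<δ , small = scale (A ℚ.+ B) ε (+-nonNeg 0≤A 0≤B) 0<ε
      N₃ , x-close = cauchy x δ 0<δ
      N₄ , y-close = cauchy y δ 0<δ
      N = (N₁ ℕ.⊔ N₂) ℕ.⊔ (N₃ ℕ.⊔ N₄)
      N₁≤ = ℕ.≤-trans (ℕ.m≤m⊔n N₁ N₂) (ℕ.m≤m⊔n (N₁ ℕ.⊔ N₂) (N₃ ℕ.⊔ N₄))
      N₂≤ = ℕ.≤-trans (ℕ.m≤n⊔m N₁ N₂) (ℕ.m≤m⊔n (N₁ ℕ.⊔ N₂) (N₃ ℕ.⊔ N₄))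
      N₃≤ = ℕ.≤-trans (ℕ.m≤m⊔n N₃ N₄) (ℕ.m≤n⊔m (N₁ ℕ.⊔ N₂) (N₃ ℕ.⊔ N₄))
      N₄≤ = ℕ.≤-trans (ℕ.m≤n⊔m N₃ N₄) (ℕ.m≤n⊔m (N₁ ℕ.⊔ N₂) (N₃ ℕ.⊔ N₄))
  in N , λ i j ≤i ≤j → begin-strict
    ∣ seq x i ℚ.* seq y i ℚ.- seq x j ℚ.* seq y j ∣                    ≤⟨ product-diff (seq x i) (seq y i) (seq x j) (seq y j) A B
                                                                            (x≤A i (ℕ.≤-trans N₁≤ ≤i)) (y≤B j (ℕ.≤-trans N₂≤ ≤j)) ⟩
    A ℚ.* ∣ seq y i ℚ.- seq y j ∣ ℚ.+ B ℚ.* ∣ seq x i ℚ.- seq x j ∣    ≤⟨ ℚ.+-mono-≤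
        (*-mono-≤ 0≤A ℚ.≤-refl (ℚ.0≤∣p∣ (seq y i ℚ.- seq y j)) (ℚ.<⇒≤ (y-close i j (ℕ.≤-trans N₄≤ ≤i) (ℕ.≤-trans N₄≤ ≤j))))
        (*-mono-≤ 0≤B ℚ.≤-refl (ℚ.0≤∣p∣ (seq x i ℚ.- seq x j)) (ℚ.<⇒≤ (x-close i j (ℕ.≤-trans N₃≤ ≤i) (ℕ.≤-trans N₃≤ ≤j)))) ⟩
    A ℚ.* δ ℚ.+ B ℚ.* δ                                                ≡⟨ sym (ℚ.*-distribʳ-+ δ A B) ⟩
    (A ℚ.+ B) ℚ.* δ                                                    <⟨ small ⟩
    ε                                                                  ∎
  where open ≤-Reasoning

------------------------------------------------------------------------
-- The exponential function, exp x = Σ xⁱ / i!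

expTerm : ℚ → ℕ → ℚ
expTerm q i = (q ^ i) ℚ.* (+ 1 / (i !)) {{i ℕ.!≢0}}

expSum : ℚ → ℕ → ℚ
expSum q zero    = expTerm q 0
expSum q (suc n) = expSum q n ℚ.+ expTerm q (suc n)

module ExpLemmas where

  recip : ℕ → ℚ
  recip i = + 1 / suc i

  0≤/ : ∀ n d .{{_ : ℕ.NonZero d}} → 0ℚ ℚ.≤ + n / d
  0≤/ n d = ℚ.nonNegative⁻¹ (+ n / d) {{ℚ.normalize-nonNeg n d}}

  /-homo-* : ∀ a b m n .{{_ : ℕ.NonZero m}} .{{_ : ℕ.NonZero n}} .{{_ : ℕ.NonZero (m ℕ.* n)}} →
    (+ (a ℕ.* b) / (m ℕ.* n)) ≡ (+ a / m) ℚ.* (+ b / n)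
  /-homo-* a b (suc m) (suc n) = ℚ.toℚᵘ-injective (begin
      ℚ.toℚᵘ (+ (a ℕ.* b) / (suc m ℕ.* suc n))                     ≈⟨ ℚ.toℚᵘ-fromℚᵘ (ℚᵘ.mkℚᵘ (+ (a ℕ.* b)) _) ⟩
      ℚᵘ.mkℚᵘ (+ (a ℕ.* b)) _                                      ≡⟨ cong (λ z → ℚᵘ.mkℚᵘ z _) (ℤ.pos-* a b) ⟩
      ℚᵘ.mkℚᵘ (+ a) m ℚᵘ.* ℚᵘ.mkℚᵘ (+ b) n                         ≈⟨ ℚᵘ.≃-sym (ℚᵘ.*-cong (ℚ.toℚᵘ-fromℚᵘ (ℚᵘ.mkℚᵘ (+ a) m)) (ℚ.toℚᵘ-fromℚᵘ (ℚᵘ.mkℚᵘ (+ b) n))) ⟩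
      ℚ.toℚᵘ (+ a / suc m) ℚᵘ.* ℚ.toℚᵘ (+ b / suc n)               ≈⟨ ℚᵘ.≃-sym (ℚ.toℚᵘ-homo-* (+ a / suc m) (+ b / suc n)) ⟩
      ℚ.toℚᵘ ((+ a / suc m) ℚ.* (+ b / suc n))                     ∎)
    where open ℚᵘ.≃-Reasoning

  /-mono-≤ : ∀ {a b m n} .{{_ : ℕ.NonZero m}} .{{_ : ℕ.NonZero n}} →
    a ℕ.* n ℕ.≤ b ℕ.* m → (+ a / m) ℚ.≤ (+ b / n)
  /-mono-≤ {a} {b} {suc m} {suc n} an≤bm = ℚ.toℚᵘ-cancel-≤ (begin
      ℚ.toℚᵘ (+ a / suc m)  ≃⟨ ℚ.toℚᵘ-fromℚᵘ (ℚᵘ.mkℚᵘ (+ a) m) ⟩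
      ℚᵘ.mkℚᵘ (+ a) m       ≤⟨ ℚᵘ.*≤* (subst₂ ℤ._≤_ (ℤ.pos-* a (suc n)) (ℤ.pos-* b (suc m)) (ℤ.+≤+ an≤bm)) ⟩
      ℚᵘ.mkℚᵘ (+ b) n       ≃⟨ ℚᵘ.≃-sym (ℚ.toℚᵘ-fromℚᵘ (ℚᵘ.mkℚᵘ (+ b) n)) ⟩
      ℚ.toℚᵘ (+ b / suc n)  ∎)
    where open ℚᵘ.≤-Reasoning

  0≤recip : ∀ i → 0ℚ ℚ.≤ recip i
  0≤recip i = 0≤/ 1 (suc i)

  recip-anti : ∀ {i j} → i ℕ.≤ j → recip j ℚ.≤ recip i
  recip-anti {i} {j} i≤j = /-mono-≤ {1} {1} {suc j} {suc i} (ℕ.*-monoʳ-≤ 1 (ℕ.s≤s i≤j))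

  recip-half : ∀ n → recip n ℚ.* ½ ℚ.≤ recip (suc n)
  recip-half n = subst (ℚ._≤ recip (suc n)) (/-homo-* 1 1 (suc n) 2)
    (/-mono-≤ {1} {1} {suc n ℕ.* 2} {suc (suc n)} (ℕ.*-monoʳ-≤ 1 (ℕ.s≤s (ℕ.s≤s (ℕ.m≤m*n n 2)))))

  recip-arch : ∀ δ → 0ℚ ℚ.< δ → ∃[ n ] recip n ℚ.≤ δ
  recip-arch δ@(mkℚ (+ zero) d _) (ℚ.*<* (ℤ.+<+ ()))
  recip-arch δ@(mkℚ (+ suc a) d _) _ = d , subst (recip d ℚ.≤_) (ℚ.↥p/↧p≡p δ)
    (/-mono-≤ {1} {suc a} {suc d} {suc d} (ℕ.*-monoˡ-≤ (suc d) (ℕ.s≤s (ℕ.z≤n {a}))))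
  recip-arch (mkℚ (ℤ.-[1+ a ]) d _) (ℚ.*<* ())

  expTerm-suc : ∀ q i → expTerm q (suc i) ≡ expTerm q i ℚ.* (q ℚ.* recip i)
  expTerm-suc q i = trans
    (cong (q ℚ.* q ^ i ℚ.*_) (/-homo-* 1 1 (suc i) (i !) {{_}} {{i ℕ.!≢0}} {{suc i ℕ.!≢0}}))
    (rearrange q (q ^ i) (recip i) ((+ 1 / (i !)) {{i ℕ.!≢0}}))
    where
    open +-*-Solver
    rearrange : ∀ q p r f → q ℚ.* p ℚ.* (r ℚ.* f) ≡ p ℚ.* f ℚ.* (q ℚ.* r)
    rearrange = solve 4 (λ q p r f → q :* p :* (r :* f) := p :* f :* (q :* r)) refl

  ∣q*r∣ : ∀ q {r} → 0ℚ ℚ.≤ r → ∣ q ℚ.* r ∣ ≡ ∣ q ∣ ℚ.* r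
  ∣q*r∣ q {r} 0≤r = trans (ℚ.∣p*q∣≡∣p∣*∣q∣ q r) (cong (∣ q ∣ ℚ.*_) (ℚ.0≤p⇒∣p∣≡p 0≤r))

  module Bounded (B : ℚ) (0≤B : 0ℚ ℚ.≤ B) where

    T : ℕ → ℚ
    T = expTerm B

    0≤T : ∀ i → 0ℚ ℚ.≤ T i
    0≤T zero    = ℚ.nonNegative⁻¹ (T 0)
    0≤T (suc i) = subst (0ℚ ℚ.≤_) (sym (expTerm-suc B i))
      (*-nonNeg (0≤T i) (*-nonNeg 0≤B (0≤recip i)))

    ∣q*recip∣≤ : ∀ q → ∣ q ∣ ℚ.≤ B → ∀ i → ∣ q ℚ.* recip i ∣ ℚ.≤ B ℚ.* recip i
    ∣q*recip∣≤ q q≤B i = subst (ℚ._≤ B ℚ.* recip i) (sym (∣q*r∣ q (0≤recip i)))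
      (*-mono-≤ (ℚ.0≤∣p∣ q) q≤B (0≤recip i) ℚ.≤-refl)

    ∣term∣≤T : ∀ q → ∣ q ∣ ℚ.≤ B → ∀ i → ∣ expTerm q i ∣ ℚ.≤ T i
    ∣term∣≤T q q≤B zero    = ℚ.≤-refl
    ∣term∣≤T q q≤B (suc i) = begin
      ∣ expTerm q (suc i) ∣                     ≡⟨ cong ∣_∣ (expTerm-suc q i) ⟩
      ∣ expTerm q i ℚ.* (q ℚ.* recip i) ∣       ≡⟨ ℚ.∣p*q∣≡∣p∣*∣q∣ (expTerm q i) (q ℚ.* recip i) ⟩
      ∣ expTerm q i ∣ ℚ.* ∣ q ℚ.* recip i ∣     ≤⟨ *-mono-≤ (ℚ.0≤∣p∣ (expTerm q i)) (∣term∣≤T q q≤B i)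
                                                     (ℚ.0≤∣p∣ (q ℚ.* recip i)) (∣q*recip∣≤ q q≤B i) ⟩
      T i ℚ.* (B ℚ.* recip i)                   ≡⟨ sym (expTerm-suc B i) ⟩
      T (suc i)                                 ∎
      where open ≤-Reasoning

    Lipschitz : (ℚ → ℚ) → Set
    Lipschitz f = ∃[ K ] 0ℚ ℚ.≤ K × (∀ p q → ∣ p ∣ ℚ.≤ B → ∣ q ∣ ℚ.≤ B →
      ∣ f p ℚ.- f q ∣ ℚ.≤ K ℚ.* ∣ p ℚ.- q ∣)

    term-lipschitz : ∀ i → Lipschitz (λ q → expTerm q i)
    term-lipschitz zero = 0ℚ , ℚ.≤-refl , λ p q _ _ →
      ℚ.≤-reflexive (sym (ℚ.*-zeroˡ ∣ p ℚ.- q ∣))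
    term-lipschitz (suc i) =
      let K , 0≤K , lip = term-lipschitz i
          K′ = T i ℚ.* r ℚ.+ B ℚ.* r ℚ.* K
      in K′
       , +-nonNeg (*-nonNeg (0≤T i) (0≤recip i)) (*-nonNeg (*-nonNeg 0≤B (0≤recip i)) 0≤K)
       , λ p q p≤B q≤B → begin
        ∣ expTerm p (suc i) ℚ.- expTerm q (suc i) ∣                                ≡⟨ cong₂ (λ s t → ∣ s ℚ.- t ∣) (expTerm-suc p i) (expTerm-suc q i) ⟩
        ∣ expTerm p i ℚ.* (p ℚ.* r) ℚ.- expTerm q i ℚ.* (q ℚ.* r) ∣                ≤⟨ product-diff (expTerm p i) (p ℚ.* r) (expTerm q i) (q ℚ.* r) (T i) (B ℚ.* r)
                                                                                        (∣term∣≤T p p≤B i) (∣q*recip∣≤ q q≤B i) ⟩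
        T i ℚ.* ∣ p ℚ.* r ℚ.- q ℚ.* r ∣ ℚ.+ B ℚ.* r ℚ.* ∣ expTerm p i ℚ.- expTerm q i ∣
                                                                                   ≡⟨ cong (λ z → T i ℚ.* z ℚ.+ B ℚ.* r ℚ.* ∣ expTerm p i ℚ.- expTerm q i ∣)
                                                                                        (trans (cong ∣_∣ (factor p q r)) (∣q*r∣ (p ℚ.- q) (0≤recip i))) ⟩
        T i ℚ.* (∣ p ℚ.- q ∣ ℚ.* r) ℚ.+ B ℚ.* r ℚ.* ∣ expTerm p i ℚ.- expTerm q i ∣
                                                                                   ≤⟨ ℚ.+-monoʳ-≤ (T i ℚ.* (∣ p ℚ.- q ∣ ℚ.* r)) (*-mono-≤ (*-nonNeg 0≤B (0≤recip i)) ℚ.≤-refl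
                                                                                        (ℚ.0≤∣p∣ (expTerm p i ℚ.- expTerm q i)) (lip p q p≤B q≤B)) ⟩
        T i ℚ.* (∣ p ℚ.- q ∣ ℚ.* r) ℚ.+ B ℚ.* r ℚ.* (K ℚ.* ∣ p ℚ.- q ∣)            ≡⟨ collect (T i) r B K ∣ p ℚ.- q ∣ ⟩
        K′ ℚ.* ∣ p ℚ.- q ∣                                                         ∎
      where
      open ≤-Reasoning
      open +-*-Solver
      r = recip i
      factor : ∀ p q r → p ℚ.* r ℚ.- q ℚ.* r ≡ (p ℚ.- q) ℚ.* r
      factor = solve 3 (λ p q r → p :* r :- q :* r := (p :- q) :* r) refl
      collect : ∀ t r b k d → t ℚ.* (d ℚ.* r) ℚ.+ b ℚ.* r ℚ.* (k ℚ.* d) ≡ (t ℚ.* r ℚ.+ b ℚ.* r ℚ.* k) ℚ.* d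
      collect = solve 5 (λ t r b k d → t :* (d :* r) :+ b :* r :* (k :* d) := (t :* r :+ b :* r :* k) :* d) refl

    sum-lipschitz : ∀ n → Lipschitz (λ q → expSum q n)
    sum-lipschitz zero    = term-lipschitz zero
    sum-lipschitz (suc n) =
      let K , 0≤K , lip  = sum-lipschitz n
          L , 0≤L , lip′ = term-lipschitz (suc n)
      in K ℚ.+ L , +-nonNeg 0≤K 0≤L , λ p q p≤B q≤B →
        let S = expSum p n ; S′ = expSum q n ; t = expTerm p (suc n) ; t′ = expTerm q (suc n)
        in begin
        ∣ (S ℚ.+ t) ℚ.- (S′ ℚ.+ t′) ∣                      ≡⟨ cong ∣_∣ (split S t S′ t′) ⟩
        ∣ (S ℚ.- S′) ℚ.+ (t ℚ.- t′) ∣                      ≤⟨ ℚ.∣p+q∣≤∣p∣+∣q∣ (S ℚ.- S′) (t ℚ.- t′) ⟩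
        ∣ S ℚ.- S′ ∣ ℚ.+ ∣ t ℚ.- t′ ∣                      ≤⟨ ℚ.+-mono-≤ (lip p q p≤B q≤B) (lip′ p q p≤B q≤B) ⟩
        K ℚ.* ∣ p ℚ.- q ∣ ℚ.+ L ℚ.* ∣ p ℚ.- q ∣            ≡⟨ sym (ℚ.*-distribʳ-+ ∣ p ℚ.- q ∣ K L) ⟩
        (K ℚ.+ L) ℚ.* ∣ p ℚ.- q ∣                          ∎
      where
      open ≤-Reasoning
      open +-*-Solver
      split : ∀ a b c d → (a ℚ.+ b) ℚ.- (c ℚ.+ d) ≡ (a ℚ.- c) ℚ.+ (b ℚ.- d)
      split = solve 4 (λ a b c d → (a :+ b) :- (c :+ d) := (a :- c) :+ (b :- d)) refl

    -- From the index M₀ on, consecutive terms of Σ Bⁱ / i! at least halve.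

    M₀ : ℕ
    M₀ = let δ , 0<δ , _ = scale B ½ 0≤B (ℚ.positive⁻¹ ½) in proj₁ (recip-arch δ 0<δ)

    ratio : ∀ {i} → M₀ ℕ.≤ i → B ℚ.* recip i ℚ.≤ ½
    ratio {i} M₀≤i =
      let δ , 0<δ , small = scale B ½ 0≤B (ℚ.positive⁻¹ ½)
      in ℚ.≤-trans
           (*-mono-≤ 0≤B ℚ.≤-refl (0≤recip i)
             (ℚ.≤-trans (recip-anti M₀≤i) (proj₂ (recip-arch δ 0<δ))))
           (ℚ.<⇒≤ small)

    T-halves : ∀ {i} → M₀ ℕ.≤ i → T (suc i) ℚ.≤ T i ℚ.* ½
    T-halves {i} M₀≤i = subst (ℚ._≤ T i ℚ.* ½) (sym (expTerm-suc B i))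
      (*-mono-≤ (0≤T i) ℚ.≤-refl (*-nonNeg 0≤B (0≤recip i)) (ratio M₀≤i))

    T-decay : ∀ n → T (n ℕ.+ M₀) ℚ.≤ T M₀ ℚ.* recip n
    T-decay zero    = ℚ.≤-reflexive (sym (ℚ.*-identityʳ (T M₀)))
    T-decay (suc n) = begin
      T (suc n ℕ.+ M₀)             ≤⟨ T-halves (ℕ.m≤n+m M₀ n) ⟩
      T (n ℕ.+ M₀) ℚ.* ½           ≤⟨ *-mono-≤ (0≤T (n ℕ.+ M₀)) (T-decay n) (ℚ.nonNegative⁻¹ ½) ℚ.≤-refl ⟩
      T M₀ ℚ.* recip n ℚ.* ½       ≡⟨ ℚ.*-assoc (T M₀) (recip n) ½ ⟩
      T M₀ ℚ.* (recip n ℚ.* ½)     ≤⟨ *-mono-≤ (0≤T M₀) ℚ.≤-refl (*-nonNeg (0≤recip n) (ℚ.nonNegative⁻¹ ½)) (recip-half n) ⟩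
      T M₀ ℚ.* recip (suc n)       ∎
      where open ≤-Reasoning

    T-small : ∀ ε → 0ℚ ℚ.< ε → ∃[ M ] M₀ ℕ.≤ M × T M ℚ.< ε
    T-small ε 0<ε =
      let δ , 0<δ , small = scale (T M₀) ε (0≤T M₀) 0<ε
          n , 1/n≤δ = recip-arch δ 0<δ
      in n ℕ.+ M₀ , ℕ.m≤n+m M₀ n
       , ℚ.≤-<-trans (ℚ.≤-trans (T-decay n) (*-mono-≤ (0≤T M₀) ℚ.≤-refl (0≤recip n) 1/n≤δ)) small

    tail′ : ∀ q → ∣ q ∣ ℚ.≤ B → ∀ {M} → M₀ ℕ.≤ M → ∀ k →
      ∣ expSum q (k ℕ.+ M) ℚ.- expSum q M ∣ ℚ.+ T (k ℕ.+ M) ℚ.≤ T M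
    tail′ q q≤B {M} M₀≤M zero = ℚ.≤-reflexive (trans
      (cong (λ z → ∣ z ∣ ℚ.+ T M) (ℚ.+-inverseʳ (expSum q M))) (ℚ.+-identityˡ (T M)))
    tail′ q q≤B {M} M₀≤M (suc k) =
      let S = expSum q (k ℕ.+ M) ; S₀ = expSum q M ; i = k ℕ.+ M ; t = expTerm q (suc i)
      in begin
      ∣ S ℚ.+ t ℚ.- S₀ ∣ ℚ.+ T (suc i)                    ≡⟨ cong (λ z → ∣ z ∣ ℚ.+ T (suc i)) (move S t S₀) ⟩
      ∣ (S ℚ.- S₀) ℚ.+ t ∣ ℚ.+ T (suc i)                  ≤⟨ ℚ.+-monoˡ-≤ (T (suc i)) (ℚ.∣p+q∣≤∣p∣+∣q∣ (S ℚ.- S₀) t) ⟩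
      ∣ S ℚ.- S₀ ∣ ℚ.+ ∣ t ∣ ℚ.+ T (suc i)                ≡⟨ ℚ.+-assoc ∣ S ℚ.- S₀ ∣ ∣ t ∣ (T (suc i)) ⟩
      ∣ S ℚ.- S₀ ∣ ℚ.+ (∣ t ∣ ℚ.+ T (suc i))              ≤⟨ ℚ.+-monoʳ-≤ ∣ S ℚ.- S₀ ∣ (ℚ.+-mono-≤
                                                               (ℚ.≤-trans (∣term∣≤T q q≤B (suc i)) halves) halves) ⟩
      ∣ S ℚ.- S₀ ∣ ℚ.+ (T i ℚ.* ½ ℚ.+ T i ℚ.* ½)          ≡⟨ cong (∣ S ℚ.- S₀ ∣ ℚ.+_)
                                                               (trans (sym (ℚ.*-distribˡ-+ (T i) ½ ½)) (ℚ.*-identityʳ (T i))) ⟩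
      ∣ S ℚ.- S₀ ∣ ℚ.+ T i                                ≤⟨ tail′ q q≤B M₀≤M k ⟩
      T M                                                 ∎
      where
      open ≤-Reasoning
      open +-*-Solver
      move : ∀ a b c → a ℚ.+ b ℚ.- c ≡ (a ℚ.- c) ℚ.+ b
      move = solve 3 (λ a b c → a :+ b :- c := (a :- c) :+ b) refl
      halves : T (suc (k ℕ.+ M)) ℚ.≤ T (k ℕ.+ M) ℚ.* ½
      halves = T-halves (ℕ.≤-trans M₀≤M (ℕ.m≤n+m M k))

    tail : ∀ q → ∣ q ∣ ℚ.≤ B → ∀ {M i} → M₀ ℕ.≤ M → M ℕ.≤ i →
      ∣ expSum q i ℚ.- expSum q M ∣ ℚ.≤ T M
    tail q q≤B {M} {i} M₀≤M M≤i = subst (λ j → ∣ expSum q j ℚ.- expSum q M ∣ ℚ.≤ T M) (ℕ.m∸n+n≡m M≤i)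
      (ℚ.≤-trans (p≤p+q _ (0≤T (i ℕ.∸ M ℕ.+ M))) (tail′ q q≤B M₀≤M (i ℕ.∸ M)))

open ExpLemmas

exp : ℝ → ℝ
exp x = real (λ n → expSum (seq x n) n) λ ε 0<ε →
  let B , 0≤B , N₁ , x≤B = bounded x
      open Bounded B 0≤B
      M , M₀≤M , T<ε/4 = T-small (half (half ε)) (half-pos (half-pos 0<ε))
      K , 0≤K , lip = sum-lipschitz M
      δ , 0<δ , Kδ<ε/2 = scale K (half ε) 0≤K (half-pos 0<ε)
      N₂ , x-close = cauchy x δ 0<δ
      N = (N₁ ℕ.⊔ N₂) ℕ.⊔ M
      N₁≤ = ℕ.≤-trans (ℕ.m≤m⊔n N₁ N₂) (ℕ.m≤m⊔n (N₁ ℕ.⊔ N₂) M)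
      N₂≤ = ℕ.≤-trans (ℕ.m≤n⊔m N₁ N₂) (ℕ.m≤m⊔n (N₁ ℕ.⊔ N₂) M)
      M≤ = ℕ.m≤n⊔m (N₁ ℕ.⊔ N₂) M
  in N , λ i j ≤i ≤j →
    let p = seq x i ; q = seq x j
        p≤B = x≤B i (ℕ.≤-trans N₁≤ ≤i)
        q≤B = x≤B j (ℕ.≤-trans N₁≤ ≤j)
        u = expSum p i ℚ.- expSum p M
        v = expSum q j ℚ.- expSum q M
        w = expSum p M ℚ.- expSum q M
    in begin-strict
    ∣ expSum p i ℚ.- expSum q j ∣               ≡⟨ cong ∣_∣ (split (expSum p i) (expSum p M) (expSum q j) (expSum q M)) ⟩
    ∣ (u ℚ.- v) ℚ.+ w ∣                         ≤⟨ ℚ.∣p+q∣≤∣p∣+∣q∣ (u ℚ.- v) w ⟩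
    ∣ u ℚ.- v ∣ ℚ.+ ∣ w ∣                       ≤⟨ ℚ.+-monoˡ-≤ ∣ w ∣ (ℚ.∣p-q∣≤∣p∣+∣q∣ u v) ⟩
    ∣ u ∣ ℚ.+ ∣ v ∣ ℚ.+ ∣ w ∣                   <⟨ ℚ.+-mono-<
        (ℚ.+-mono-<
          (ℚ.≤-<-trans (tail p p≤B M₀≤M (ℕ.≤-trans M≤ ≤i)) T<ε/4)
          (ℚ.≤-<-trans (tail q q≤B M₀≤M (ℕ.≤-trans M≤ ≤j)) T<ε/4))
        (ℚ.≤-<-trans (ℚ.≤-trans (lip p q p≤B q≤B)
          (*-mono-≤ 0≤K ℚ.≤-refl (ℚ.0≤∣p∣ (p ℚ.- q))
            (ℚ.<⇒≤ (x-close i j (ℕ.≤-trans N₂≤ ≤i) (ℕ.≤-trans N₂≤ ≤j))))) Kδ<ε/2) ⟩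
    half (half ε) ℚ.+ half (half ε) ℚ.+ half ε  ≡⟨ cong (ℚ._+ half ε) (half+half (half ε)) ⟩
    half ε ℚ.+ half ε                           ≡⟨ half+half ε ⟩
    ε                                           ∎
  where
  open ≤-Reasoning
  open +-*-Solver
  split : ∀ a b c d → a ℚ.- c ≡ ((a ℚ.- b) ℚ.- (c ℚ.- d)) ℚ.+ (b ℚ.- d)
  split = solve 4 (λ a b c d → a :- c := ((a :- b) :- (c :- d)) :+ (b :- d)) refl

------------------------------------------------------------------------
-- Logarithms and reciprocals

-- "log x = y"; since exp is injective, y is determined by x up to _≃_.

IsLog : ℝ → ℝ → Set
IsLog x y = exp y ≃ x

-- "1 / x = y".

IsReciprocal : ℝ → ℝ → Set
IsReciprocal x y = x * y ≃ 1ℝ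

-- x ^ y = exp (y log x), where l is log x.

power : (x l : ℝ) → IsLog x l → ℝ → ℝ
power x l _ y = exp (y * l)

{-# OPTIONS --safe #-}
-- Rosenfeld's weighted counting replaces the Lovász local lemma.  Colour each
-- point red with probability r / (r + 1), and let P(S) be the probability
-- that S contains no red k-progression and no blue m-progression.  Adding a
-- point v to S only creates progressions e through v, and the event that e is
-- monochromatic is independent of what happens on S ∖ e; comparing P(S ∖ e)
-- with P(S) by induction gives P(S ∪ v) ≥ (1 - 1 / (2 (r + 1))) P(S), as long
-- as the expected number of monochromatic progressions through v is small.
-- With r about k / log k this allows n = (k / log k)^(m-1) up to a constant.
--
-- The factor k^(1 / log log k) = exp (L / log L), where L = log k, beats every
-- power of L: the partial sums S of exp satisfy S(b) ≥ b^(m+1) / (m+1)!, and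
-- b = L / log L is larger than any power of L with exponent below 1.

module Submission where

-- The 2 in `1 - 1 / (2 (r + 1))` makes red progressions affordable. Fixing the colour of a
-- progression of length l contributes `(w / (r + 1)) ^ l`, with w the weight of the colour, while
-- putting its points back into the set costs up to `(2 (r + 1) / (2 r + 1)) ^ l`. The product
-- `(2 w / (2 r + 1)) ^ l` still decays for red, where w = r. If each point were allowed to cost its
-- full probability of being blue, the two powers would cancel exactly.
--
-- On the analytic side, `exp` is the diagonal sequence of partial sums S_n(x_n), so the exponent
-- laws are only available as S_n(a + b) ≤ S_n(a) S_n(b) ≤ S_2n(a + b) for nonnegative a, b. The
-- estimate is therefore made at one index, with rationals q, y, ρ that approximate log k, log log k
-- and its reciprocal only up to bounded errors: the product of S((m - 1 - ρ) q) and S(ρ q) is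
-- compared with k^(m-1), and every error becomes a constant factor that the growth of S(ρ q)
-- absorbs.

module Counting where

  open import Data.Bool.Base using (Bool; true; false)
  import Data.Bool.Properties as Bool
  open import Data.List.Base using (List; []; _∷_; _++_; length; map; filter; upTo; applyUpTo; cartesianProductWith)
  open import Data.List.Properties using (length-map; length-++; length-applyUpTo; length-filter; filter-notAll; map-++; length-upTo)
  open import Data.List.Membership.Propositional using (_∈_; _∉_)
  open import Data.List.Membership.Propositional.Properties
    using (∈-filter⁺; ∈-filter⁻; ∈-++⁺ˡ; ∈-++⁺ʳ; ∈-++⁻; ∈-applyUpTo⁻; ∈-upTo⁺; ∈-cartesianProductWith⁺; ∈-cartesianProductWith⁻)
  open import Data.List.Relation.Binary.Subset.Propositional using (_⊆_)
  open import Data.List.Relation.Unary.All as All using (All; []; _∷_)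
  import Data.List.Relation.Unary.All.Properties as All
  open import Data.List.Relation.Unary.AllPairs using ([]; _∷_)
  open import Data.List.Relation.Unary.Any as Any using (Any; here; there)
  open import Data.List.Relation.Unary.Unique.Propositional using (Unique)
  import Data.List.Relation.Unary.Unique.Propositional.Properties as Unique
  open import Data.Maybe.Base using (Maybe; just; nothing)
  import Data.Maybe.Properties as Maybe
  open import Data.Nat.Base
  open import Data.Nat.DivMod using (_/_; _%_; m≡m%n+[m/n]*n; m%n<n; m/n*n≤m; m/n≤m)
  open import Data.Nat.Induction using (Acc; acc; <-wellFounded)
  open import Data.Nat.ListAction using (sum)
  open import Data.Nat.ListAction.Properties using (sum-++)
  open import Data.Nat.Properties
  open import Data.Nat.Solver using (module +-*-Solver)
  open import Data.Product.Base using (_×_; _,_; ∃-syntax; proj₁; proj₂)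
  open import Data.Sum.Base using (inj₁; inj₂)
  open import Data.Fin.Base as Fin using (Fin; toℕ; fromℕ<)
  open import Data.Fin.Properties using (toℕ<n; toℕ-fromℕ<)
  open import Data.Vec.Base using (Vec; []; _∷_; lookup)
  open import Defs using (HasMonoAP; Unavoidable)
  open import Function.Base using (_∘_; case_of_)
  open import Relation.Binary.PropositionalEquality
    using (_≡_; _≢_; refl; sym; trans; cong; cong₂; subst)
  open import Relation.Nullary
    using (¬_; Dec; yes; no; contradiction; ¬?; _→-dec_)
  open import Data.List.Membership.DecPropositional _≟_ using (_∈?_)

  -- Partial lookup, indicators and averages.

  infix 9 _!_

  -- Points are plain naturals and may exceed the length; such a point has neither colour, so an
  -- event containing it is never monochromatic.
  _!_ : ∀ {a} {A : Set a} {n} → Vec A n → ℕ → Maybe A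
  []       ! _     = nothing
  (x ∷ xs) ! zero  = just x
  (x ∷ xs) ! suc i = xs ! i

  indicator : ∀ {p} {P : Set p} → Dec P → ℕ
  indicator (yes _) = 1
  indicator (no _)  = 0

  indicator-yes : ∀ {p} {P : Set p} (P? : Dec P) → P → indicator P? ≡ 1
  indicator-yes (yes _) _ = refl
  indicator-yes (no ¬p) p = contradiction p ¬p

  indicator-mono : ∀ {p q} {P : Set p} {Q : Set q} (P? : Dec P) (Q? : Dec Q) →
    (P → Q) → indicator P? ≤ indicator Q?
  indicator-mono (no _)  _  _   = z≤n
  indicator-mono (yes p) Q? P⇒Q = ≤-reflexive (sym (indicator-yes Q? (P⇒Q p)))

  indicator-cong : ∀ {p q} {P : Set p} {Q : Set q} (P? : Dec P) (Q? : Dec Q) →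
    (P → Q) → (Q → P) → indicator P? ≡ indicator Q?
  indicator-cong P? Q? P⇒Q Q⇒P = ≤-antisym (indicator-mono P? Q? P⇒Q) (indicator-mono Q? P? Q⇒P)

  ^-distribʳ-* : ∀ ℓ a b → (a * b) ^ ℓ ≡ a ^ ℓ * b ^ ℓ
  ^-distribʳ-* zero    a b = refl
  ^-distribʳ-* (suc ℓ) a b = trans (cong (a * b *_) (^-distribʳ-* ℓ a b))
    (solve 4 (λ a b x y → a :* b :* (x :* y) := a :* x :* (b :* y)) refl a b (a ^ ℓ) (b ^ ℓ))
    where open +-*-Solver

  Event : Set
  Event = List ℕ × Bool

  -- Cleared of denominators: at most `N` terms, each at most c / (N K), add up to at most c / K.
  -- The case `N = 0` stands apart because `N` cannot be cancelled there.
  sum-≤-average : ∀ {A : Set} (f : A → ℕ) K N c xs → length xs ≤ N →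
    (∀ x → x ∈ xs → N * (K * f x) ≤ c) → K * sum (map f xs) ≤ c
  sum-≤-average f K zero c [] _ _ = ≤-trans (≤-reflexive (*-zeroʳ K)) z≤n
  sum-≤-average f K N@(suc _) c xs len≤N each =
    *-cancelˡ-≤ N (≤-trans (total xs each) (*-monoˡ-≤ c len≤N))
    where
    open ≤-Reasoning
    total : ∀ xs → (∀ x → x ∈ xs → N * (K * f x) ≤ c) → N * (K * sum (map f xs)) ≤ length xs * c
    total []       _    = ≤-reflexive (trans (cong (N *_) (*-zeroʳ K)) (*-zeroʳ N))
    total (x ∷ xs) each = begin
      N * (K * (f x + sum (map f xs)))               ≡⟨ cong (N *_) (*-distribˡ-+ K (f x) _) ⟩
      N * (K * f x + K * sum (map f xs))             ≡⟨ *-distribˡ-+ N (K * f x) _ ⟩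
      N * (K * f x) + N * (K * sum (map f xs))       ≤⟨ +-mono-≤ (each x (here refl)) (total xs (λ y y∈ → each y (there y∈))) ⟩
      c + length xs * c                              ∎

  -- Weighted counting of colourings.

  module WeightedCount (r : ℕ) where

    weight : Bool → ℕ
    weight false = 1
    weight true  = r

    -- D / (2 * Q) = 1 - 1 / (2 * Q) is half way between 1 and the probability of red.

    Q D : ℕ
    Q = suc r
    D = suc (2 * r)

    -- An unnormalised expectation: dividing by `Q ^ n` would give the mean over independent
    -- colours, red (`true`) with probability `r / Q`. Weights keep everything in ℕ.
    E : ∀ n → (Vec Bool n → ℕ) → ℕ
    E zero    f = f []
    E (suc n) f = weight true * E n (f ∘ (true ∷_)) + weight false * E n (f ∘ (false ∷_))

    E-mono : ∀ n {f g} → (∀ χ → f χ ≤ g χ) → E n f ≤ E n g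
    E-mono zero    f≤g = f≤g []
    E-mono (suc n) f≤g = +-mono-≤
      (*-monoʳ-≤ (weight true) (E-mono n (λ χ → f≤g (true ∷ χ))))
      (*-monoʳ-≤ (weight false) (E-mono n (λ χ → f≤g (false ∷ χ))))

    E-cong : ∀ n {f g} → (∀ χ → f χ ≡ g χ) → E n f ≡ E n g
    E-cong n f≗g = ≤-antisym (E-mono n (λ χ → ≤-reflexive (f≗g χ))) (E-mono n (λ χ → ≤-reflexive (sym (f≗g χ))))

    E-zero : ∀ n → E n (λ _ → 0) ≡ 0
    E-zero zero    = refl
    E-zero (suc n) rewrite E-zero n | *-zeroʳ r = refl

    E-+ : ∀ n f g → E n (λ χ → f χ + g χ) ≡ E n f + E n g
    E-+ zero    f g = refl
    E-+ (suc n) f g = trans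
      (cong₂ (λ x y → r * x + 1 * y) (E-+ n _ _) (E-+ n _ _))
      (solve 5 (λ r a b c d → r :* (a :+ b) :+ con 1 :* (c :+ d) := (r :* a :+ con 1 :* c) :+ (r :* b :+ con 1 :* d))
         refl r (E n (f ∘ (true ∷_))) (E n (g ∘ (true ∷_))) (E n (f ∘ (false ∷_))) (E n (g ∘ (false ∷_))))
      where open +-*-Solver

    E-sum : ∀ n {A : Set} (f : A → Vec Bool n → ℕ) xs →
      E n (λ χ → sum (map (λ x → f x χ) xs)) ≡ sum (map (λ x → E n (f x)) xs)
    E-sum n f []       = E-zero n
    E-sum n f (x ∷ xs) = trans (E-+ n (f x) _) (cong (E n (f x) +_) (E-sum n f xs))

    E-positive : ∀ n (f : Vec Bool n → ℕ) → 0 < E n f → ∃[ χ ] 0 < f χ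
    E-positive zero    f 0<E = [] , 0<E
    E-positive (suc n) f 0<E with E n (f ∘ (true ∷_)) in eq₁ | E n (f ∘ (false ∷_)) in eq₂
    ... | suc _ | _ = let χ , 0<f = E-positive n (f ∘ (true ∷_)) (subst (0 <_) (sym eq₁) z<s) in true ∷ χ , 0<f
    ... | zero | suc _ = let χ , 0<f = E-positive n (f ∘ (false ∷_)) (subst (0 <_) (sym eq₂) z<s) in false ∷ χ , 0<f
    ... | zero | zero = contradiction (subst (0 <_) (trans (+-identityʳ _) (*-zeroʳ r)) 0<E) λ ()

    E-one : ∀ n → 0 < E n (λ _ → 1)
    E-one zero    = z<s
    E-one (suc n) = ≤-trans (E-one n) (≤-trans (≤-reflexive (sym (*-identityˡ _))) (m≤n+m _ (r * E n (λ _ → 1))))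

    IndependentOf : ∀ {n} → ℕ → (Vec Bool n → ℕ) → Set
    IndependentOf x f = ∀ χ χ′ → (∀ y → y ≢ x → χ ! y ≡ χ′ ! y) → f χ ≡ f χ′

    infix 4 _has?_at_

    _has?_at_ : ∀ {n} (χ : Vec Bool n) b x → Dec (χ ! x ≡ just b)
    χ has? b at x = Maybe.≡-dec Bool._≟_ (χ ! x) (just b)

    -- For a point below `n` this is an equality, obtained by averaging over the colour of that
    -- point alone. Beyond `n` the left side is 0, whence the inequality.
    condition-point : ∀ n (f : Vec Bool n → ℕ) x b → IndependentOf x f →
      Q * E n (λ χ → indicator (χ has? b at x) * f χ) ≤ weight b * E n f
    condition-point zero f x b ind = ≤-trans (≤-reflexive (*-zeroʳ Q)) z≤n
    condition-point (suc n) f zero b ind = ≤-reflexive (begin-equality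
        Q * (r * E n (λ χ → indicator (just-≟ true b) * f (true ∷ χ)) + 1 * E n (λ χ → indicator (just-≟ false b) * f (false ∷ χ)))
          ≡⟨ cong (Q *_) (pick b) ⟩
        Q * (weight b * E n (f ∘ (true ∷_)))
          ≡⟨ solve 3 (λ r w e → (con 1 :+ r) :* (w :* e) := w :* (r :* e :+ con 1 :* e)) refl r (weight b) (E n (f ∘ (true ∷_))) ⟩
        weight b * (r * E n (f ∘ (true ∷_)) + 1 * E n (f ∘ (true ∷_)))
          ≡⟨ cong (λ e → weight b * (r * E n (f ∘ (true ∷_)) + 1 * e)) same ⟩
        weight b * (r * E n (f ∘ (true ∷_)) + 1 * E n (f ∘ (false ∷_))) ∎)
      where
      open ≤-Reasoning
      open +-*-Solver
      just-≟ : ∀ c b → Dec (just c ≡ just b)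
      just-≟ c b = Maybe.≡-dec Bool._≟_ (just c) (just b)
      same : E n (f ∘ (true ∷_)) ≡ E n (f ∘ (false ∷_))
      same = E-cong n λ χ → ind _ _ λ { zero 0≢0 → contradiction refl 0≢0 ; (suc _) _ → refl }
      pick : ∀ b → r * E n (λ χ → indicator (just-≟ true b) * f (true ∷ χ)) + 1 * E n (λ χ → indicator (just-≟ false b) * f (false ∷ χ))
           ≡ weight b * E n (f ∘ (true ∷_))
      pick true  = trans (cong₂ (λ x y → r * x + 1 * y) (E-cong n (λ χ → *-identityˡ _)) (E-zero n)) (+-identityʳ _)
      pick false = trans (cong₂ (λ x y → r * x + 1 * y) (E-zero n) (trans (E-cong n (λ χ → *-identityˡ _)) (sym same)))
                         (cong (_+ 1 * E n (f ∘ (true ∷_))) (*-zeroʳ r))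
    condition-point (suc n) f (suc x) b ind = begin
        Q * (r * A + 1 * B)              ≡⟨ solve 4 (λ q r a b → q :* (r :* a :+ con 1 :* b) := r :* (q :* a) :+ con 1 :* (q :* b)) refl Q r A B ⟩
        r * (Q * A) + 1 * (Q * B)        ≤⟨ +-mono-≤ (*-monoʳ-≤ r (IH true)) (*-monoʳ-≤ 1 (IH false)) ⟩
        r * (weight b * E n (f ∘ (true ∷_))) + 1 * (weight b * E n (f ∘ (false ∷_)))
          ≡⟨ solve 4 (λ w r a b → r :* (w :* a) :+ con 1 :* (w :* b) := w :* (r :* a :+ con 1 :* b)) refl (weight b) r (E n (f ∘ (true ∷_))) (E n (f ∘ (false ∷_))) ⟩
        weight b * (r * E n (f ∘ (true ∷_)) + 1 * E n (f ∘ (false ∷_))) ∎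
      where
      open ≤-Reasoning
      open +-*-Solver
      A = E n (λ χ → indicator (χ has? b at x) * f (true ∷ χ))
      B = E n (λ χ → indicator (χ has? b at x) * f (false ∷ χ))
      IH : ∀ c → Q * E n (λ χ → indicator (χ has? b at x) * f (c ∷ χ)) ≤ weight b * E n (f ∘ (c ∷_))
      IH c = condition-point n (f ∘ (c ∷_)) x b λ χ χ′ agree → ind _ _
        λ { zero _ → refl ; (suc y) sy≢sx → agree y (sy≢sx ∘ cong suc) }

    -- Kept as a product over the points, rather than as one decision, so that `condition` can peel
    -- them off one at a time.
    monoIndicator : ∀ {n} → Bool → List ℕ → Vec Bool n → ℕ
    monoIndicator b []       χ = 1
    monoIndicator b (x ∷ xs) χ = indicator (χ has? b at x) * monoIndicator b xs χ

    monoIndicator-independent : ∀ {n} b xs {x} → x ∉ xs → IndependentOf {n} x (monoIndicator b xs)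
    monoIndicator-independent b [] x∉ χ χ′ agree = refl
    monoIndicator-independent b (y ∷ xs) {x} x∉ χ χ′ agree = cong₂ _*_
      (indicator-cong (χ has? b at y) (χ′ has? b at y) (trans (sym same)) (trans same))
      (monoIndicator-independent b xs (x∉ ∘ there) χ χ′ agree)
      where same = agree y (λ y≡x → x∉ (here (sym y≡x)))

    -- Iterates `condition-point`: the factors that remain must not look at the point just peeled
    -- off, which is where `Unique` enters.
    condition : ∀ n b xs → Unique xs → (f : Vec Bool n → ℕ) → (∀ x → x ∈ xs → IndependentOf x f) →
      Q ^ length xs * E n (λ χ → monoIndicator b xs χ * f χ) ≤ weight b ^ length xs * E n f
    condition n b []       _               f ind = ≤-reflexive (cong (1 *_) (E-cong n (λ χ → *-identityˡ (f χ))))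
    condition n b (x ∷ xs) (x≢ ∷ unique) f ind = begin
      Q * Q ^ ℓ * E n (λ χ → indicator (χ has? b at x) * monoIndicator b xs χ * f χ)
        ≡⟨ cong₂ _*_ (*-comm Q (Q ^ ℓ)) (E-cong n (λ χ → *-assoc (indicator (χ has? b at x)) (monoIndicator b xs χ) (f χ))) ⟩
      Q ^ ℓ * Q * E n (λ χ → indicator (χ has? b at x) * (monoIndicator b xs χ * f χ))
        ≡⟨ *-assoc (Q ^ ℓ) Q _ ⟩
      Q ^ ℓ * (Q * E n (λ χ → indicator (χ has? b at x) * (monoIndicator b xs χ * f χ)))
        ≤⟨ *-monoʳ-≤ (Q ^ ℓ) (condition-point n _ x b λ χ χ′ agree → cong₂ _*_
             (monoIndicator-independent b xs (λ x∈ → All.lookup x≢ x∈ refl) χ χ′ agree) (ind x (here refl) χ χ′ agree)) ⟩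
      Q ^ ℓ * (weight b * E n (λ χ → monoIndicator b xs χ * f χ))
        ≡⟨ solve 3 (λ q w e → q :* (w :* e) := w :* (q :* e)) refl (Q ^ ℓ) (weight b) _ ⟩
      weight b * (Q ^ ℓ * E n (λ χ → monoIndicator b xs χ * f χ))
        ≤⟨ *-monoʳ-≤ (weight b) (condition n b xs unique f (λ y y∈ → ind y (there y∈))) ⟩
      weight b * (weight b ^ ℓ * E n f)
        ≡⟨ sym (*-assoc (weight b) (weight b ^ ℓ) _) ⟩
      weight b * weight b ^ ℓ * E n f ∎
      where
      open ≤-Reasoning
      open +-*-Solver
      ℓ = length xs

    infixl 6 _-ᵖ_ _∖_

    _-ᵖ_ : List ℕ → ℕ → List ℕ
    S -ᵖ x = filter (λ y → ¬? (y ≟ x)) S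

    _∖_ : List ℕ → List ℕ → List ℕ
    S ∖ []       = S
    S ∖ (x ∷ xs) = (S -ᵖ x) ∖ xs

    -ᵖ-⊆ : ∀ S x → S -ᵖ x ⊆ S
    -ᵖ-⊆ S x y∈ = proj₁ (∈-filter⁻ (λ y → ¬? (y ≟ x)) y∈)

    ∖-⊆ : ∀ S xs → S ∖ xs ⊆ S
    ∖-⊆ S []       = λ y∈ → y∈
    ∖-⊆ S (x ∷ xs) = -ᵖ-⊆ S x ∘ ∖-⊆ (S -ᵖ x) xs

    ∈-∖⇒∉ : ∀ S xs {y} → y ∈ S ∖ xs → y ∉ xs
    ∈-∖⇒∉ S (x ∷ xs) y∈ (here refl) = proj₂ (∈-filter⁻ (λ y → ¬? (y ≟ x)) {xs = S} (∖-⊆ (S -ᵖ x) xs y∈)) refl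
    ∈-∖⇒∉ S (x ∷ xs) y∈ (there y∈xs) = ∈-∖⇒∉ (S -ᵖ x) xs y∈ y∈xs

    ⊆-∷-ᵖ : ∀ S x → S ⊆ x ∷ (S -ᵖ x)
    ⊆-∷-ᵖ S x {y} y∈ with y ≟ x
    ... | yes refl = here refl
    ... | no y≢x   = there (∈-filter⁺ (λ y → ¬? (y ≟ x)) y∈ y≢x)

    -- The counting induction for avoiding monochromatic events.

    module Avoidance (n : ℕ) (F : List Event) where

      Mono : Vec Bool n → Event → Set
      Mono χ (e , b) = All (λ x → χ ! x ≡ just b) e

      mono? : ∀ χ ev → Dec (Mono χ ev)
      mono? χ (e , b) = All.all? (λ x → χ has? b at x) e

      inside? : ∀ S (ev : Event) → Dec (All (_∈ S) (proj₁ ev))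
      inside? S (e , _) = All.all? (_∈? S) e

      -- Only membership in `S` matters here; the length of the list serves as the measure of the
      -- induction in `P-extend`.
      Good : List ℕ → Vec Bool n → Set
      Good S χ = All (λ ev → All (_∈ S) (proj₁ ev) → ¬ Mono χ ev) F

      good? : ∀ S χ → Dec (Good S χ)
      good? S χ = All.all? (λ ev → inside? S ev →-dec ¬? (mono? χ ev)) F

      Good-anti : ∀ {S T} χ → S ⊆ T → Good T χ → Good S χ
      Good-anti χ S⊆T = All.map (λ g in-S → g (All.map S⊆T in-S))

      P : List ℕ → ℕ
      P S = E n (λ χ → indicator (good? S χ))

      P-anti : ∀ {S T} → S ⊆ T → P T ≤ P S
      P-anti {S} {T} S⊆T = E-mono n (λ χ → indicator-mono (good? T χ) (good? S χ) (Good-anti χ S⊆T))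

      Good-independent : ∀ {S x} → x ∉ S → IndependentOf x (λ χ → indicator (good? S χ))
      Good-independent {S} {x} x∉S χ χ′ agree = indicator-cong (good? S χ) (good? S χ′)
          (transfer χ χ′ agree) (transfer χ′ χ (λ y y≢ → sym (agree y y≢)))
        where
        transfer : ∀ χ χ′ → (∀ y → y ≢ x → χ ! y ≡ χ′ ! y) → Good S χ → Good S χ′
        transfer χ χ′ agree = All.map λ g in-S mono′ → g in-S
          (All.zipWith (λ { {y} (y∈S , eq) → trans (agree y λ { refl → x∉S y∈S }) eq }) (in-S , mono′))

      monoIndicator-Mono : ∀ χ e b → Mono χ (e , b) → monoIndicator b e χ ≡ 1
      monoIndicator-Mono χ []      b []         = refl
      monoIndicator-Mono χ (x ∷ e) b (eq ∷ eqs) =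
        cong₂ _*_ (indicator-yes (χ has? b at x) eq) (monoIndicator-Mono χ e b eqs)

      -- Goodness is demanded only off `e`, so the second factor does not depend on the colours of
      -- `e` and `condition` can separate the two.
      hit : List ℕ → Event → Vec Bool n → ℕ
      hit S (e , b) χ = monoIndicator b e χ * indicator (good? (S ∖ e) χ)

      module _ (through : ℕ → List Event)
               (covers : ∀ {ev v} → ev ∈ F → v ∈ proj₁ ev → ev ∈ through v) where

        -- A colouring good on `S` but not on `v ∷ S` has a monochromatic event inside `v ∷ S` that
        -- is not inside `S`; it contains `v`, so `through v` lists it. Goodness off that event is
        -- inherited from `S`.
        union-bound : ∀ S v χ →
          indicator (good? S χ) ≤ indicator (good? (v ∷ S) χ) + sum (map (λ ev → hit S ev χ) (through v))
        union-bound S v χ with good? S χ | good? (v ∷ S) χ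
        ... | no _  | _      = z≤n
        ... | yes _ | yes _  = s≤s z≤n
        ... | yes g | no bad = find F (λ ev∈ → ev∈) g bad
          where
          member≤sum : ∀ {evs ev} → ev ∈ evs → hit S ev χ ≤ sum (map (λ ev → hit S ev χ) evs)
          member≤sum (here refl) = m≤m+n _ _
          member≤sum (there ev∈) = ≤-trans (member≤sum ev∈) (m≤n+m _ _)
          blame : ∀ {ev} → ev ∈ F → All (_∈ v ∷ S) (proj₁ ev) → Mono χ ev → (All (_∈ S) (proj₁ ev) → ¬ Mono χ ev) →
            1 ≤ sum (map (λ ev → hit S ev χ) (through v))
          blame {e , b} ev∈ in-vS mono notS with v ∈? e
          ... | no v∉e = contradiction mono (notS (All.tabulate λ {y} y∈e → case All.lookup in-vS y∈e of
                  λ { (here refl) → contradiction y∈e v∉e ; (there y∈S) → y∈S }))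
          ... | yes v∈e = ≤-trans
                (≤-reflexive (sym (cong₂ _*_ (monoIndicator-Mono χ e b mono)
                  (indicator-yes (good? (S ∖ e) χ) (Good-anti χ (∖-⊆ S e) g)))))
                (member≤sum (covers ev∈ v∈e))
          find : ∀ evs → (∀ {ev} → ev ∈ evs → ev ∈ F) →
            All (λ ev → All (_∈ S) (proj₁ ev) → ¬ Mono χ ev) evs →
            ¬ All (λ ev → All (_∈ v ∷ S) (proj₁ ev) → ¬ Mono χ ev) evs →
            1 ≤ sum (map (λ ev → hit S ev χ) (through v))
          find [] _ _ bad = contradiction [] bad
          find (ev ∷ evs) ⊆F (g ∷ gs) bad with inside? (v ∷ S) ev | mono? χ ev
          ... | yes in-vS | yes mono = blame (⊆F (here refl)) in-vS mono g
          ... | no out | _ = find evs (⊆F ∘ there) gs λ all → bad ((λ in-vS → contradiction in-vS out) ∷ all)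
          ... | _ | no ¬mono = find evs (⊆F ∘ there) gs λ all → bad ((λ _ → ¬mono) ∷ all)

        Extendable : List ℕ → Set
        Extendable S = ∀ v → D * P S ≤ (2 * Q) * P (v ∷ S)

        -- `-ᵖ` deletes every copy of `x`, so if `x` occurs in `S` the remaining list is strictly
        -- shorter and the induction hypothesis applies to it. Otherwise the set is unchanged and
        -- `D ≤ 2 * Q` suffices.
        remove-point : ∀ S x → (∀ S′ → length S′ < length S → Extendable S′) → D * P (S -ᵖ x) ≤ (2 * Q) * P S
        remove-point S x IH with x ∈? S
        ... | yes x∈S = ≤-trans (IH (S -ᵖ x) (filter-notAll _ S (Any.map (λ { refl x≢x → x≢x refl }) x∈S)) x)
                                (*-monoʳ-≤ (2 * Q) (P-anti (⊆-∷-ᵖ S x)))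
        ... | no x∉S = *-mono-≤ D≤2Q (P-anti λ {y} y∈ → ∈-filter⁺ (λ y → ¬? (y ≟ x)) y∈ λ { refl → x∉S y∈ })
          where
          D≤2Q : D ≤ 2 * Q
          D≤2Q = subst (D ≤_) (solve 1 (λ r → con 2 :+ con 2 :* r := con 2 :* (con 1 :+ r)) refl r) (n≤1+n D)
            where open +-*-Solver

        remove-list : ∀ S xs → (∀ S′ → length S′ < length S → Extendable S′) →
          D ^ length xs * P (S ∖ xs) ≤ (2 * Q) ^ length xs * P S
        remove-list S []       IH = ≤-refl
        remove-list S (x ∷ xs) IH = begin
          D * D ^ ℓ * P ((S -ᵖ x) ∖ xs)          ≡⟨ *-assoc D (D ^ ℓ) _ ⟩
          D * (D ^ ℓ * P ((S -ᵖ x) ∖ xs))        ≤⟨ *-monoʳ-≤ D (remove-list (S -ᵖ x) xs λ S′ S′< →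
                                                      IH S′ (<-≤-trans S′< (length-filter _ S))) ⟩
          D * ((2 * Q) ^ ℓ * P (S -ᵖ x))         ≡⟨ solve 3 (λ d q p → d :* (q :* p) := q :* (d :* p)) refl D ((2 * Q) ^ ℓ) _ ⟩
          (2 * Q) ^ ℓ * (D * P (S -ᵖ x))         ≤⟨ *-monoʳ-≤ ((2 * Q) ^ ℓ) (remove-point S x IH) ⟩
          (2 * Q) ^ ℓ * ((2 * Q) * P S)          ≡⟨ solve 3 (λ a q p → a :* (q :* p) := q :* a :* p) refl ((2 * Q) ^ ℓ) (2 * Q) _ ⟩
          (2 * Q) * (2 * Q) ^ ℓ * P S            ∎
          where
          open ≤-Reasoning
          open +-*-Solver
          ℓ = length xs

        -- The powers of `Q` from `condition` and from `remove-list` cancel. The remaining ratio is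
        -- small for blue because 2 is far below a large `D`, but for red only because `2 * r < D`
        -- is raised to a long length.
        hit-bound : ∀ S e b → Unique e → (∀ S′ → length S′ < length S → Extendable S′) →
          D ^ length e * E n (hit S (e , b)) ≤ (2 * weight b) ^ length e * P S
        hit-bound S e b unique IH = *-cancelˡ-≤ (Q ^ ℓ) {{m^n≢0 Q ℓ}} (begin
          Q ^ ℓ * (D ^ ℓ * X)                       ≡⟨ solve 3 (λ a b c → a :* (b :* c) := b :* (a :* c)) refl (Q ^ ℓ) (D ^ ℓ) X ⟩
          D ^ ℓ * (Q ^ ℓ * X)                       ≤⟨ *-monoʳ-≤ (D ^ ℓ) (condition n b e unique _ λ x x∈e →
                                                         Good-independent (λ x∈ → ∈-∖⇒∉ S e x∈ x∈e)) ⟩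
          D ^ ℓ * (w ^ ℓ * P (S ∖ e))               ≡⟨ solve 3 (λ a b c → a :* (b :* c) := b :* (a :* c)) refl (D ^ ℓ) (w ^ ℓ) _ ⟩
          w ^ ℓ * (D ^ ℓ * P (S ∖ e))               ≤⟨ *-monoʳ-≤ (w ^ ℓ) (remove-list S e IH) ⟩
          w ^ ℓ * ((2 * Q) ^ ℓ * P S)               ≡⟨ cong (λ z → w ^ ℓ * (z * P S)) (^-distribʳ-* ℓ 2 Q) ⟩
          w ^ ℓ * (2 ^ ℓ * Q ^ ℓ * P S)             ≡⟨ solve 4 (λ w t q p → w :* (t :* q :* p) := q :* (t :* w :* p)) refl (w ^ ℓ) (2 ^ ℓ) (Q ^ ℓ) _ ⟩
          Q ^ ℓ * (2 ^ ℓ * w ^ ℓ * P S)             ≡⟨ cong (λ z → Q ^ ℓ * (z * P S)) (sym (^-distribʳ-* ℓ 2 w)) ⟩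
          Q ^ ℓ * ((2 * w) ^ ℓ * P S)               ∎)
          where
          open ≤-Reasoning
          open +-*-Solver
          ℓ = length e
          w = weight b
          X = E n (hit S (e , b))

        -- Together with `hit-bound` this makes each hit at most P(S) / (4 Q N), so the whole list
        -- costs at most P(S) / (4 Q): half of the admissible loss, because blue and red each need a
        -- share.
        Sparse : List Event → Set
        Sparse evs = ∃[ N ] length evs ≤ N ×
          (∀ {e b} → (e , b) ∈ evs → Unique e × N * (2 * (2 * Q)) * (2 * weight b) ^ length e ≤ D ^ length e)

        sparse-sum : ∀ S evs → Sparse evs → (∀ S′ → length S′ < length S → Extendable S′) →
          2 * (2 * Q) * sum (map (λ ev → E n (hit S ev)) evs) ≤ P S
        sparse-sum S evs (N , len≤N , sparse) IH =
          sum-≤-average (λ ev → E n (hit S ev)) (2 * (2 * Q)) N (P S) evs len≤N each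
          where
          open ≤-Reasoning
          open +-*-Solver
          each : ∀ ev → ev ∈ evs → N * (2 * (2 * Q) * E n (hit S ev)) ≤ P S
          each (e , b) ev∈ = let unique , small = sparse ev∈ ; ℓ = length e ; X = E n (hit S (e , b)) ; K = 2 * (2 * Q) in
            *-cancelˡ-≤ (D ^ ℓ) {{m^n≢0 D ℓ}} (begin
              D ^ ℓ * (N * (K * X))                    ≡⟨ solve 4 (λ d n k x → d :* (n :* (k :* x)) := n :* k :* (d :* x)) refl (D ^ ℓ) N K X ⟩
              N * K * (D ^ ℓ * X)                      ≤⟨ *-monoʳ-≤ (N * K) (hit-bound S e b unique IH) ⟩
              N * K * ((2 * weight b) ^ ℓ * P S)       ≡⟨ sym (*-assoc (N * K) ((2 * weight b) ^ ℓ) (P S)) ⟩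
              N * K * (2 * weight b) ^ ℓ * P S         ≤⟨ *-monoˡ-≤ (P S) small ⟩
              D ^ ℓ * P S                              ∎)

        module _ (sparse : ∀ v → ∃[ A ] ∃[ B ] through v ≡ A ++ B × Sparse A × Sparse B) where

          P-extend : ∀ S → Acc _<_ (length S) → Extendable S
          P-extend S (acc rs) v with sparse v
          -- The loss is at most `p / (2 * Q)` in total. Adding `2 * p` to both sides avoids
          -- subtraction, because `D + 1 = 2 * Q`.
          ... | A , B , split , sparse-A , sparse-B = *-cancelˡ-≤ 2 (+-cancelʳ-≤ (2 * p) _ _ (begin
            2 * (D * p) + 2 * p                            ≡⟨ solve 2 (λ r p → con 2 :* ((con 1 :+ con 2 :* r) :* p) :+ con 2 :* p := con 2 :* (con 2 :* (con 1 :+ r)) :* p) refl r p ⟩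
            K * p                                          ≤⟨ *-monoʳ-≤ K bound ⟩
            K * (p′ + (sum (map X A) + sum (map X B)))     ≡⟨ solve 4 (λ k a b c → k :* (a :+ (b :+ c)) := k :* a :+ (k :* b :+ k :* c)) refl K p′ (sum (map X A)) (sum (map X B)) ⟩
            K * p′ + (K * sum (map X A) + K * sum (map X B)) ≤⟨ +-monoʳ-≤ (K * p′) (+-mono-≤ (sparse-sum S A sparse-A IH) (sparse-sum S B sparse-B IH)) ⟩
            K * p′ + (p + p)                               ≡⟨ solve 3 (λ q p p′ → con 2 :* q :* p′ :+ (p :+ p) := con 2 :* (q :* p′) :+ con 2 :* p) refl (2 * Q) p p′ ⟩
            2 * (2 * Q * p′) + 2 * p                       ∎))
            where
            open ≤-Reasoning
            open +-*-Solver
            K = 2 * (2 * Q)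
            p = P S
            p′ = P (v ∷ S)
            X : Event → ℕ
            X ev = E n (hit S ev)
            IH : ∀ S′ → length S′ < length S → Extendable S′
            IH S′ S′< = P-extend S′ (rs S′<)
            bound : p ≤ p′ + (sum (map X A) + sum (map X B))
            bound = begin
              p                                        ≤⟨ E-mono n (union-bound S v) ⟩
              E n (λ χ → indicator (good? (v ∷ S) χ) + sum (map (λ ev → hit S ev χ) (through v)))
                                                       ≡⟨ trans (E-+ n _ _) (cong (p′ +_) (E-sum n (hit S) (through v))) ⟩
              p′ + sum (map X (through v))             ≡⟨ cong (λ evs → p′ + sum (map X evs)) split ⟩
              p′ + sum (map X (A ++ B))                ≡⟨ cong (λ z → p′ + sum z) (map-++ X A B) ⟩
              p′ + sum (map X A ++ map X B)            ≡⟨ cong (p′ +_) (sum-++ (map X A) (map X B)) ⟩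
              p′ + (sum (map X A) + sum (map X B))     ∎

          -- Each new point keeps at least the fraction `D / (2 * Q)`, which is positive even for
          -- `r = 0`. The base case needs nonempty events: an empty one would lie inside `[]` and be
          -- vacuously monochromatic.
          P-positive : (∀ {ev} → ev ∈ F → proj₁ ev ≢ []) → ∀ S → 0 < P S
          P-positive nonempty [] = <-≤-trans (E-one n) (E-mono n λ χ → ≤-reflexive (sym
            (indicator-yes (good? [] χ) (All.tabulate λ ev∈ in-[] _ → nonempty ev∈ (all-∉ in-[])))))
            where
            all-∉ : ∀ {e} → All (_∈ []) e → e ≡ []
            all-∉ [] = refl
          P-positive nonempty (v ∷ S) with P (v ∷ S) in eq
          ... | suc _ = z<s
          ... | zero  = contradiction
            (≤-trans (*-mono-≤ {1} {D} (s≤s z≤n) (P-positive nonempty S))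
              (≤-trans (P-extend S (<-wellFounded _) v) (≤-reflexive (trans (cong (2 * Q *_) eq) (*-zeroʳ (2 * Q)))))) λ ()

          good-coloring : (∀ {ev} → ev ∈ F → proj₁ ev ≢ []) → ∀ S → ∃[ χ ] Good S χ
          good-coloring nonempty S with E-positive n _ (P-positive nonempty S)
          ... | χ , 0<ind with good? S χ
          ...   | yes good = χ , good

  -- Arithmetic progressions as events.

  length-cartesianProductWith : ∀ {A B C : Set} (f : A → B → C) xs ys →
    length (cartesianProductWith f xs ys) ≡ length xs * length ys
  length-cartesianProductWith f []       ys = refl
  length-cartesianProductWith f (x ∷ xs) ys = trans (length-++ (map (f x) ys))
    (cong₂ _+_ (length-map (f x) ys) (length-cartesianProductWith f xs ys))

  !-lookup : ∀ {A : Set} {n} (xs : Vec A n) i → xs ! toℕ i ≡ just (lookup xs i)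
  !-lookup (x ∷ xs) Fin.zero    = refl
  !-lookup (x ∷ xs) (Fin.suc i) = !-lookup xs i

  -- The common difference is `suc d`, hence positive, and points count from 0: the interval [1, n]
  -- becomes `upTo n`.
  progression : ℕ → ℕ → ℕ → List ℕ
  progression ℓ a d = applyUpTo (λ i → a + i * suc d) ℓ

  progression-unique : ∀ ℓ a d → Unique (progression ℓ a d)
  progression-unique ℓ a d = Unique.applyUpTo⁺₁ _ ℓ λ {i} {j} i<j _ eq →
    <⇒≢ i<j (*-cancelʳ-≡ i j (suc d) (+-cancelˡ-≡ a _ _ eq))

  module Progressions (r k m n : ℕ) (2≤k : 2 ≤ k) (2≤m : 2 ≤ m) where
    open WeightedCount r

    -- Progressions running past `n` are included; they do not lie inside `upTo n`, so goodness
    -- there puts no constraint on them.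
    progressions : ℕ → Bool → List Event
    progressions ℓ b = cartesianProductWith (λ a d → progression ℓ a d , b) (upTo n) (upTo n)

    -- For v < i (d + 1) the truncated start is that of a progression missing
    -- v; it does no harm in an upper bound.

    progressionsThrough : ℕ → Bool → ℕ → List Event
    progressionsThrough ℓ b v =
      cartesianProductWith (λ i d → progression ℓ (v ∸ i * suc d) d , b) (upTo ℓ) (upTo n)

    events : List Event
    events = progressions m false ++ progressions k true

    through : ℕ → List Event
    through v = progressionsThrough m false v ++ progressionsThrough k true v

    open Avoidance n events

    progressions-covers : ∀ ℓ b {ev v} → ev ∈ progressions ℓ b → v ∈ proj₁ ev → ev ∈ progressionsThrough ℓ b v
    progressions-covers ℓ b ev∈ v∈ with ∈-cartesianProductWith⁻ _ (upTo n) (upTo n) ev∈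
    ... | a , d , _ , d∈ , refl with ∈-applyUpTo⁻ (λ i → a + i * suc d) v∈
    ... | i , i<ℓ , refl = subst (λ a′ → (progression ℓ a′ d , b) ∈ progressionsThrough ℓ b (a + i * suc d))
      (m+n∸n≡m a (i * suc d)) (∈-cartesianProductWith⁺ _ (∈-upTo⁺ i<ℓ) d∈)

    covers : ∀ {ev v} → ev ∈ events → v ∈ proj₁ ev → ev ∈ through v
    covers ev∈ v∈ with ∈-++⁻ (progressions m false) ev∈
    ... | inj₁ ev∈ = ∈-++⁺ˡ (progressions-covers m false ev∈ v∈)
    ... | inj₂ ev∈ = ∈-++⁺ʳ _ (progressions-covers k true ev∈ v∈)

    progressionsThrough-sparse : ∀ ℓ b v → ℓ * n * (2 * (2 * Q)) * (2 * weight b) ^ ℓ ≤ D ^ ℓ →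
      Sparse through covers (progressionsThrough ℓ b v)
    progressionsThrough-sparse ℓ b v small = ℓ * n
      , ≤-reflexive (trans (length-cartesianProductWith _ (upTo ℓ) (upTo n)) (cong₂ _*_ (length-upTo ℓ) (length-upTo n)))
      , each
      where
      each : ∀ {e c} → (e , c) ∈ progressionsThrough ℓ b v →
        Unique e × ℓ * n * (2 * (2 * Q)) * (2 * weight c) ^ length e ≤ D ^ length e
      each ev∈ with ∈-cartesianProductWith⁻ _ (upTo ℓ) (upTo n) ev∈
      ... | i , d , _ , _ , refl = progression-unique ℓ (v ∸ i * suc d) d
          , subst (λ j → ℓ * n * (2 * (2 * Q)) * (2 * weight b) ^ j ≤ D ^ j) (sym (length-applyUpTo _ ℓ)) small

    nonempty : ∀ ℓ b → 2 ≤ ℓ → ∀ {ev} → ev ∈ progressions ℓ b → proj₁ ev ≢ []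
    nonempty (suc ℓ) b _ ev∈ with ∈-cartesianProductWith⁻ _ (upTo n) (upTo n) ev∈
    ... | _ , _ , _ , _ , refl = λ ()

    -- The first term refutes a start of 0, since the elements of [1, n] are positive; the second
    -- term, present because `2 ≤ ℓ`, bounds the difference.
    mono-event : ∀ (χ : Vec Bool n) b ℓ → 2 ≤ ℓ → HasMonoAP (lookup χ) b ℓ →
      ∃[ e ] (e , b) ∈ progressions ℓ b × All (_∈ upTo n) e × Mono χ (e , b)
    mono-event χ b (suc zero) (s≤s ()) _
    mono-event χ b (suc (suc ℓ)) _ (zero , d , 1≤d , term) with term Fin.zero
    ... | _ , () , _
    mono-event χ b ℓ@(suc (suc ℓ′)) _ (suc a , suc d , 1≤d , term) =
        progression ℓ a d
      , ∈-cartesianProductWith⁺ _ (∈-upTo⁺ a<n) (∈-upTo⁺ d<n)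
      , All.applyUpTo⁺₁ _ ℓ (λ i<ℓ → let x , eq , _ = term′ i<ℓ in subst (_∈ upTo n) eq (∈-upTo⁺ (toℕ<n x)))
      , All.applyUpTo⁺₁ _ ℓ (λ i<ℓ → let x , eq , colour = term′ i<ℓ in
          subst (λ y → χ ! y ≡ just b) eq (trans (!-lookup χ x) (cong just colour)))
      where
      term′ : ∀ {i} → i < ℓ → ∃[ x ] toℕ {n} x ≡ a + i * suc d × lookup χ x ≡ b
      term′ i<ℓ with term (fromℕ< i<ℓ)
      ... | x , eq , colour = x , trans (suc-injective eq) (cong (λ i → a + i * suc d) (toℕ-fromℕ< i<ℓ)) , colour
      a<n : a < n
      a<n = let x , eq , _ = term′ {0} z<s in subst (_< n) (trans eq (+-identityʳ a)) (toℕ<n x)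
      d<n : d < n
      d<n = let x , eq , _ = term′ {1} (s≤s z<s) in ≤-trans
        (≤-trans (m≤m+n (suc d) 0) (≤-trans (m≤n+m (1 * suc d) a) (≤-reflexive (sym eq)))) (<⇒≤ (toℕ<n x))

    avoidable : m * n * (2 * (2 * Q)) * 2 ^ m ≤ D ^ m → k * n * (2 * (2 * Q)) * (2 * r) ^ k ≤ D ^ k →
      ¬ Unavoidable k m n
    avoidable small-m small-k unavoidable with good-coloring through covers
      (λ v → _ , _ , refl , progressionsThrough-sparse m false v small-m , progressionsThrough-sparse k true v small-k)
      all-nonempty (upTo n)
      where
      all-nonempty : ∀ {ev} → ev ∈ events → proj₁ ev ≢ []
      all-nonempty ev∈ with ∈-++⁻ (progressions m false) ev∈
      ... | inj₁ ev∈ = nonempty m false 2≤m ev∈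
      ... | inj₂ ev∈ = nonempty k true 2≤k ev∈
    ... | χ , good with unavoidable (lookup χ)
    ... | inj₁ ap = let _ , e∈ , in-range , mono = mono-event χ true k 2≤k ap in
                    All.lookup good (∈-++⁺ʳ _ e∈) in-range mono
    ... | inj₂ ap = let _ , e∈ , in-range , mono = mono-event χ false m 2≤m ap in
                    All.lookup good (∈-++⁺ˡ e∈) in-range mono

  -- Growth of powers and the choice of `r`.

  bernoulli : ∀ s j → s ^ j * (s + j) ≤ s * suc s ^ j
  bernoulli s zero    = ≤-reflexive (solve 1 (λ s → con 1 :* (s :+ con 0) := s :* con 1) refl s)
    where open +-*-Solver
  bernoulli s (suc j) = begin
    s * s ^ j * (s + suc j)                ≤⟨ m≤m+n _ (s ^ j * j) ⟩
    s * s ^ j * (s + suc j) + s ^ j * j    ≡⟨ solve 3 (λ s j x → s :* x :* (s :+ (con 1 :+ j)) :+ x :* j := (con 1 :+ s) :* (x :* (s :+ j))) refl s j (s ^ j) ⟩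
    suc s * (s ^ j * (s + j))              ≤⟨ *-monoʳ-≤ (suc s) (bernoulli s j) ⟩
    suc s * (s * suc s ^ j)                ≡⟨ solve 2 (λ s y → (con 1 :+ s) :* (s :* y) := s :* ((con 1 :+ s) :* y)) refl s (suc s ^ j) ⟩
    s * (suc s * suc s ^ j)                ∎
    where
    open ≤-Reasoning
    open +-*-Solver

  power-doubles : ∀ s .{{_ : NonZero s}} → 2 * s ^ s ≤ suc s ^ s
  power-doubles s = *-cancelˡ-≤ s (≤-trans
    (≤-reflexive (solve 2 (λ s x → s :* (con 2 :* x) := x :* (s :+ s)) refl s (s ^ s))) (bernoulli s s))
    where open +-*-Solver

  -- By Bernoulli, `(1 + 1 / s) ^ s ≥ 2`: every block of `s` factors gains a doubling, and `t` such
  -- blocks fit into `k`.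
  power-grows : ∀ s .{{_ : NonZero s}} t k → s * t ≤ k → 2 ^ t * s ^ k ≤ suc s ^ k
  power-grows s t k st≤k = begin
    2 ^ t * s ^ k                              ≡⟨ cong (λ j → 2 ^ t * s ^ j) (sym (m+[n∸m]≡n st≤k)) ⟩
    2 ^ t * s ^ (s * t + (k ∸ s * t))          ≡⟨ cong (2 ^ t *_) (trans (^-distribˡ-+-* s (s * t) _) (cong (_* s ^ (k ∸ s * t)) (sym (^-*-assoc s s t)))) ⟩
    2 ^ t * ((s ^ s) ^ t * s ^ (k ∸ s * t))    ≡⟨ trans (sym (*-assoc (2 ^ t) _ _)) (cong (_* s ^ (k ∸ s * t)) (sym (^-distribʳ-* t 2 (s ^ s)))) ⟩
    (2 * s ^ s) ^ t * s ^ (k ∸ s * t)          ≤⟨ *-mono-≤ (^-monoˡ-≤ t (power-doubles s)) (^-monoˡ-≤ (k ∸ s * t) (n≤1+n s)) ⟩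
    (suc s ^ s) ^ t * suc s ^ (k ∸ s * t)      ≡⟨ cong (_* suc s ^ (k ∸ s * t)) (^-*-assoc (suc s) s t) ⟩
    suc s ^ (s * t) * suc s ^ (k ∸ s * t)      ≡⟨ sym (^-distribˡ-+-* (suc s) (s * t) _) ⟩
    suc s ^ (s * t + (k ∸ s * t))              ≡⟨ cong (suc s ^_) (m+[n∸m]≡n st≤k) ⟩
    suc s ^ k                                  ∎
    where open ≤-Reasoning

  -- Here `m` is one less than the length of the blue progressions. The power comes from `k / r`
  -- being about twice `t`, the prefactor from the `suc m * n` blue progressions through a point and
  -- the constants of `Sparse`. With `l` about log₂ k it is of order (log k)^m.
  lossFactor : ℕ → ℕ → ℕ
  lossFactor m l = 4 * suc m * 2 ^ suc m * (2 * (3 + (2 + m) * l)) ^ m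

  lossFactor-nonZero : ∀ m l → NonZero (lossFactor m l)
  lossFactor-nonZero m l = m*n≢0 (4 * suc m * 2 ^ suc m) (c ^ m)
    {{m*n≢0 (4 * suc m) (2 ^ suc m) {{_}} {{m^n≢0 2 (suc m)}}}} {{m^n≢0 c m}}
    where c = 2 * (3 + (2 + m) * l)

  -- Red has probability r / (r + 1) with r about k / (2 t), where t exceeds
  -- log₂ of the number of k-progressions through a point.

  module LowerBound (k m n l : ℕ) (2≤k : 2 ≤ k) (1≤m : 1 ≤ m) (k≤2^l : k ≤ 2 ^ l) where

    t c r : ℕ
    t = 3 + (2 + m) * l
    c = 2 * t
    r = k / c

    module _ (small : n * lossFactor m l ≤ k ^ m) where
      open ≤-Reasoning
      open +-*-Solver

      n≤k^m : n ≤ k ^ m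
      n≤k^m = ≤-trans (m≤m*n n (lossFactor m l) {{lossFactor-nonZero m l}}) small

      k≤c[1+r] : k ≤ c * suc r
      k≤c[1+r] = begin
        k                ≡⟨ m≡m%n+[m/n]*n k c ⟩
        k % c + r * c    ≤⟨ +-monoˡ-≤ (r * c) (<⇒≤ (m%n<n k c)) ⟩
        c + r * c        ≡⟨ *-comm (suc r) c ⟩
        c * suc r        ∎

      1+r≤1+2r : suc r ≤ suc (2 * r)
      1+r≤1+2r = s≤s (m≤n*m r 2)

      few-short : suc m * n * (2 * (2 * suc r)) * 2 ^ suc m ≤ suc (2 * r) ^ suc m
      few-short = begin
        suc m * n * (2 * (2 * suc r)) * 2 ^ suc m
          ≡⟨ solve 4 (λ m n r p → m :* n :* (con 2 :* (con 2 :* r)) :* p := r :* (n :* (con 4 :* m :* p))) refl (suc m) n (suc r) (2 ^ suc m) ⟩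
        suc r * (n * (4 * suc m * 2 ^ suc m))
          -- One factor `suc (2 * r)` pays for the `suc r` demanded by sparseness; only the other
          -- `m` are left to compete with `n`.
          ≤⟨ *-mono-≤ 1+r≤1+2r (≤-trans main (^-monoˡ-≤ m 1+r≤1+2r)) ⟩
        suc (2 * r) * suc (2 * r) ^ m ∎
        where
        main : n * (4 * suc m * 2 ^ suc m) ≤ suc r ^ m
        main = *-cancelˡ-≤ (c ^ m) {{m^n≢0 c m}} (begin
          c ^ m * (n * (4 * suc m * 2 ^ suc m))    ≡⟨ solve 3 (λ a b c → a :* (b :* c) := b :* (c :* a)) refl (c ^ m) n (4 * suc m * 2 ^ suc m) ⟩
          n * lossFactor m l                       ≤⟨ small ⟩
          k ^ m                                    ≤⟨ ^-monoˡ-≤ m k≤c[1+r] ⟩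
          (c * suc r) ^ m                          ≡⟨ ^-distribʳ-* m c (suc r) ⟩
          c ^ m * suc r ^ m                        ∎)

      few-long : k * n * (2 * (2 * suc r)) * (2 * r) ^ k ≤ suc (2 * r) ^ k
      few-long = by-cases r refl
        where
        by-cases : ∀ r′ → r′ ≡ r → k * n * (2 * (2 * suc r′)) * (2 * r′) ^ k ≤ suc (2 * r′) ^ k
        -- `power-grows` needs a nonzero base, but for `r = 0` the left side vanishes because `k` is
        -- positive.
        by-cases zero _ = ≤-trans (≤-reflexive (trans (cong (k * n * 4 *_) (0^k (≤-trans (s≤s z≤n) 2≤k))) (*-zeroʳ (k * n * 4)))) z≤n
          where
          0^k : ∀ {k} → 1 ≤ k → 0 ^ k ≡ 0
          0^k (s≤s _) = refl
        by-cases r′@(suc _) eq = ≤-trans (*-monoˡ-≤ ((2 * r′) ^ k) coefficient) (power-grows (2 * r′) t k (begin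
          2 * r′ * t    ≡⟨ solve 2 (λ r t → con 2 :* r :* t := r :* (con 2 :* t)) refl r′ t ⟩
          r′ * c        ≡⟨ cong (_* c) eq ⟩
          k / c * c     ≤⟨ m/n*n≤m k c ⟩
          k             ∎))
          where
          1≤k : 1 ≤ k
          1≤k = ≤-trans (s≤s z≤n) 2≤k
          1+r≤2k : suc r′ ≤ 2 * k
          1+r≤2k = subst (λ z → suc z ≤ 2 * k) (sym eq) (≤-trans (+-mono-≤ 1≤k (m/n≤m k c)) (≤-reflexive (cong (k +_) (sym (+-identityʳ k)))))
          -- From `n ≤ k ^ m` and `suc r′ ≤ 2 * k` the coefficient is at most `8 * k ^ (2 + m)`: the
          -- origin of the 3 and the `2 + m` in `t`.
          coefficient : k * n * (2 * (2 * suc r′)) ≤ 2 ^ t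
          coefficient = begin
            k * n * (2 * (2 * suc r′))        ≤⟨ *-mono-≤ (*-monoʳ-≤ k n≤k^m) (*-monoʳ-≤ 2 (*-monoʳ-≤ 2 1+r≤2k)) ⟩
            k * k ^ m * (2 * (2 * (2 * k)))   ≡⟨ solve 2 (λ k p → k :* p :* (con 2 :* (con 2 :* (con 2 :* k))) := con 8 :* (k :* (k :* p))) refl k (k ^ m) ⟩
            8 * k ^ (2 + m)                   ≤⟨ *-monoʳ-≤ 8 (^-monoˡ-≤ (2 + m) k≤2^l) ⟩
            8 * (2 ^ l) ^ (2 + m)             ≡⟨ cong (8 *_) (trans (^-*-assoc 2 l (2 + m)) (cong (2 ^_) (*-comm l (2 + m)))) ⟩
            8 * 2 ^ ((2 + m) * l)             ≡⟨ sym (^-distribˡ-+-* 2 3 ((2 + m) * l)) ⟩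
            2 ^ t                             ∎

    unavoidable-large : Unavoidable k (suc m) n → k ^ m < n * lossFactor m l
    unavoidable-large unavoidable = ≰⇒> λ small →
      Progressions.avoidable r k (suc m) n 2≤k (s≤s 1≤m) (few-short small) (few-long small) unavoidable

-- Rational inequalities for partial sums of the exponential series.

module Exponential where

  import Data.Integer.Base as ℤ
  import Data.Integer.Properties as ℤ
  open import Data.Nat.Base as ℕ using (ℕ; zero; suc; _!)
  import Data.Nat.Properties as ℕ
  open import Data.Product.Base using (_×_; _,_; ∃-syntax; proj₁; proj₂)
  open import Data.Rational.Base
  open import Data.Rational.Properties
  open import Data.Rational.Solver using (module +-*-Solver)
  import Data.Rational.Unnormalised.Base as ℚᵘ
  import Data.Rational.Unnormalised.Properties as ℚᵘ
  open import Data.Sum.Base using (inj₁; inj₂)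
  open import Function.Base using (_∘_)
  open import Relation.Binary.PropositionalEquality
    using (_≡_; refl; sym; trans; cong; cong₂; subst; subst₂; module ≡-Reasoning)
  open import Defs using (expTerm; expSum; module RationalLemmas; module ExpLemmas)
  open RationalLemmas using (*-mono-≤; *-nonNeg; +-nonNeg; p≤p+q)
  open ExpLemmas
  open import Algebra.Definitions.RawSemiring +-*-rawSemiring using (_^_)

  ι : ℕ → ℚ
  ι n = ℤ.+ n / 1

  ι-* : ∀ a b → ι (a ℕ.* b) ≡ ι a * ι b
  ι-* a b = /-homo-* a b 1 1

  ι-+ : ∀ a b → ι (a ℕ.+ b) ≡ ι a + ι b
  ι-+ a b = toℚᵘ-injective (begin
      toℚᵘ (ι (a ℕ.+ b))                    ≈⟨ toℚᵘ-fromℚᵘ (ℚᵘ.mkℚᵘ (ℤ.+ (a ℕ.+ b)) 0) ⟩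
      ℚᵘ.mkℚᵘ (ℤ.+ (a ℕ.+ b)) 0               ≡⟨ cong (λ z → ℚᵘ.mkℚᵘ z 0) (trans (ℤ.pos-+ a b) (cong₂ ℤ._+_ (sym (ℤ.*-identityʳ (ℤ.+ a))) (sym (ℤ.*-identityʳ (ℤ.+ b))))) ⟩
      ℚᵘ.mkℚᵘ (ℤ.+ a) 0 ℚᵘ.+ ℚᵘ.mkℚᵘ (ℤ.+ b) 0  ≈⟨ ℚᵘ.≃-sym (ℚᵘ.+-cong (toℚᵘ-fromℚᵘ (ℚᵘ.mkℚᵘ (ℤ.+ a) 0)) (toℚᵘ-fromℚᵘ (ℚᵘ.mkℚᵘ (ℤ.+ b) 0))) ⟩
      toℚᵘ (ι a) ℚᵘ.+ toℚᵘ (ι b)            ≈⟨ ℚᵘ.≃-sym (toℚᵘ-homo-+ (ι a) (ι b)) ⟩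
      toℚᵘ (ι a + ι b)                      ∎)
    where open ℚᵘ.≃-Reasoning

  ι-suc : ∀ n → ι (suc n) ≡ 1ℚ + ι n
  ι-suc = ι-+ 1

  ι-^ : ∀ a n → ι (a ℕ.^ n) ≡ ι a ^ n
  ι-^ a zero    = refl
  ι-^ a (suc n) = trans (ι-* a (a ℕ.^ n)) (cong (ι a *_) (ι-^ a n))

  ι-mono-≤ : ∀ {a b} → a ℕ.≤ b → ι a ≤ ι b
  ι-mono-≤ {a} {b} a≤b = /-mono-≤ {a} {b} {1} {1} (ℕ.*-monoˡ-≤ 1 a≤b)

  0≤ι : ∀ n → 0ℚ ≤ ι n
  0≤ι n = 0≤/ n 1

  ι-mono-< : ∀ {a b} → a ℕ.< b → ι a < ι b
  ι-mono-< {a} {b} a<b = <-≤-trans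
    (subst₂ _<_ (+-identityˡ (ι a)) (sym (ι-suc a)) (+-monoˡ-< (ι a) (positive⁻¹ 1ℚ))) (ι-mono-≤ a<b)

  ι-cancel-≤ : ∀ {a b} → ι a ≤ ι b → a ℕ.≤ b
  ι-cancel-≤ {a} {b} ιa≤ιb = ℕ.≮⇒≥ λ b<a → <-irrefl refl (<-≤-trans (ι-mono-< b<a) ιa≤ιb)

  ι-suc-recip : ∀ n → ι (suc n) * recip n ≡ 1ℚ
  ι-suc-recip n = trans (sym (/-homo-* (suc n) 1 1 (suc n)))
    (≤-antisym (/-mono-≤ {suc n ℕ.* 1} {1} {1 ℕ.* suc n} {1} (ℕ.≤-reflexive swap))
               (/-mono-≤ {1} {suc n ℕ.* 1} {1} {1 ℕ.* suc n} (ℕ.≤-reflexive (sym swap))))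
    where
    swap : suc n ℕ.* 1 ℕ.* 1 ≡ 1 ℕ.* (1 ℕ.* suc n)
    swap = trans (ℕ.*-identityʳ (suc n ℕ.* 1)) (trans (ℕ.*-comm (suc n) 1) (sym (ℕ.*-identityˡ (1 ℕ.* suc n))))

  -- The witness is the floor plus one, which for an integer `q` is `q + 1` rather than the true
  -- ceiling.
  ceiling-bounds : ∀ q → 0ℚ ≤ q → ∃[ u ] q ≤ ι u × ι u ≤ q + 1ℚ
  ceiling-bounds (mkℚ (ℤ.+ a) d c) _ = suc v
      , subst (_≤ ι (suc v)) (↥p/↧p≡p q) (/-mono-≤ {a} {suc v} {suc d} {1} (begin
          a ℕ.* 1                      ≡⟨ ℕ.*-identityʳ a ⟩
          a                            ≡⟨ m≡m%n+[m/n]*n a (suc d) ⟩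
          a % suc d ℕ.+ v ℕ.* suc d    ≤⟨ ℕ.+-monoˡ-≤ (v ℕ.* suc d) (ℕ.<⇒≤ (m%n<n a (suc d))) ⟩
          suc v ℕ.* suc d              ∎))
      , subst (_≤ q + 1ℚ) (trans (+-comm (ι v) 1ℚ) (sym (ι-suc v))) (+-monoˡ-≤ 1ℚ
          (subst (ι v ≤_) (↥p/↧p≡p q) (/-mono-≤ {v} {a} {1} {suc d}
            (ℕ.≤-trans (m/n*n≤m a (suc d)) (ℕ.≤-reflexive (sym (ℕ.*-identityʳ a)))))))
    where
    open import Data.Nat.DivMod using (_%_; m≡m%n+[m/n]*n; m%n<n; m/n*n≤m)
    open ℕ.≤-Reasoning
    q = mkℚ (ℤ.+ a) d c
    v = a Data.Nat.DivMod./ suc d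
  ceiling-bounds (mkℚ (ℤ.-[1+ a ]) d c) (*≤* ())

  p≤∣p∣ : ∀ p → p ≤ ∣ p ∣
  p≤∣p∣ p with ≤-total 0ℚ p
  ... | inj₁ 0≤p = ≤-reflexive (sym (0≤p⇒∣p∣≡p 0≤p))
  ... | inj₂ p≤0 = ≤-trans p≤0 (0≤∣p∣ p)

  ∣p-q∣≤⇒p≤q+ : ∀ p q {ε} → ∣ p - q ∣ ≤ ε → p ≤ q + ε
  ∣p-q∣≤⇒p≤q+ p q {ε} close = begin
    p             ≡⟨ solve 2 (λ p q → p := q :+ (p :- q)) refl p q ⟩
    q + (p - q)   ≤⟨ +-monoʳ-≤ q (≤-trans (p≤∣p∣ (p - q)) close) ⟩
    q + ε         ∎
    where
    open ≤-Reasoning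
    open +-*-Solver

  ∣p-q∣≡∣q-p∣ : ∀ p q → ∣ p - q ∣ ≡ ∣ q - p ∣
  ∣p-q∣≡∣q-p∣ p q = trans (sym (∣-p∣≡∣p∣ (p - q))) (cong ∣_∣ (solve 2 (λ p q → :- (p :- q) := q :- p) refl p q))
    where open +-*-Solver

  ^-nonNeg : ∀ {p} n → 0ℚ ≤ p → 0ℚ ≤ p ^ n
  ^-nonNeg zero    _   = nonNegative⁻¹ 1ℚ
  ^-nonNeg (suc n) 0≤p = *-nonNeg 0≤p (^-nonNeg n 0≤p)

  ^-monoˡ-≤ : ∀ {p q} n → 0ℚ ≤ p → p ≤ q → p ^ n ≤ q ^ n
  ^-monoˡ-≤ zero    _   _   = ≤-refl
  ^-monoˡ-≤ (suc n) 0≤p p≤q = *-mono-≤ 0≤p p≤q (^-nonNeg n 0≤p) (^-monoˡ-≤ n 0≤p p≤q)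

  *-^ : ∀ p q n → (p * q) ^ n ≡ p ^ n * q ^ n
  *-^ p q zero    = refl
  *-^ p q (suc n) = trans (cong ((p * q) *_) (*-^ p q n))
    (solve 4 (λ a b x y → a :* b :* (x :* y) := a :* x :* (b :* y)) refl p q (p ^ n) (q ^ n))
    where open +-*-Solver

  -- The sign of `p` is left open, since it will be a partial sum at a negative argument. If `p` is
  -- at least `c` it is nonnegative, and multiplying by `q` cannot shrink it.
  ≤-cancel-factor : ∀ {p q c} → 1ℚ ≤ q → 0ℚ ≤ c → p * q ≤ c → p ≤ c
  ≤-cancel-factor {p} {q} {c} 1≤q 0≤c pq≤c with ≤-total p c
  ... | inj₁ p≤c = p≤c
  ... | inj₂ c≤p = ≤-trans
    (subst (_≤ p * q) (*-identityʳ p) (*-mono-≤ (≤-trans 0≤c c≤p) ≤-refl (nonNegative⁻¹ 1ℚ) 1≤q)) pq≤c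

  -- Cauchy products

  sumTo : (ℕ → ℚ) → ℕ → ℚ
  sumTo f zero    = f 0
  sumTo f (suc n) = sumTo f n + f (suc n)

  conv : (ℕ → ℚ) → (ℕ → ℚ) → ℕ → ℚ
  conv f g zero    = f 0 * g 0
  conv f g (suc n) = f 0 * g (suc n) + conv (f ∘ suc) g n

  sumTo-cong : ∀ {f g} → (∀ i → f i ≡ g i) → ∀ n → sumTo f n ≡ sumTo g n
  sumTo-cong f≗g zero    = f≗g 0
  sumTo-cong f≗g (suc n) = cong₂ _+_ (sumTo-cong f≗g n) (f≗g (suc n))

  sumTo-mono : ∀ {f g} → (∀ i → f i ≤ g i) → ∀ n → sumTo f n ≤ sumTo g n
  sumTo-mono f≤g zero    = f≤g 0
  sumTo-mono f≤g (suc n) = +-mono-≤ (sumTo-mono f≤g n) (f≤g (suc n))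

  sumTo-nonNeg : ∀ {f} → (∀ i → 0ℚ ≤ f i) → ∀ n → 0ℚ ≤ sumTo f n
  sumTo-nonNeg 0≤f zero    = 0≤f 0
  sumTo-nonNeg 0≤f (suc n) = +-nonNeg (sumTo-nonNeg 0≤f n) (0≤f (suc n))

  sumTo-extend : ∀ {f} → (∀ i → 0ℚ ≤ f i) → ∀ p q → sumTo f q ≤ sumTo f (p ℕ.+ q)
  sumTo-extend 0≤f zero    q = ≤-refl
  sumTo-extend 0≤f (suc p) q = ≤-trans (sumTo-extend 0≤f p q) (p≤p+q _ (0≤f (suc (p ℕ.+ q))))

  sumTo-shift : ∀ f n → sumTo f (suc n) ≡ f 0 + sumTo (f ∘ suc) n
  sumTo-shift f zero    = refl
  sumTo-shift f (suc n) = trans (cong (_+ f (suc (suc n))) (sumTo-shift f n)) (+-assoc (f 0) (sumTo (f ∘ suc) n) _)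

  sumTo-linear : ∀ c f g n → sumTo (λ i → c * f i + g i) n ≡ c * sumTo f n + sumTo g n
  sumTo-linear c f g zero    = refl
  sumTo-linear c f g (suc n) = trans (cong (_+ (c * f (suc n) + g (suc n))) (sumTo-linear c f g n))
    (solve 5 (λ c a b x y → c :* a :+ b :+ (c :* x :+ y) := c :* (a :+ x) :+ (b :+ y)) refl
      c (sumTo f n) (sumTo g n) (f (suc n)) (g (suc n)))
    where open +-*-Solver

  sumTo-conv : ∀ f g n → sumTo (conv f g) (suc n) ≡ f 0 * sumTo g (suc n) + sumTo (conv (f ∘ suc) g) n
  sumTo-conv f g n = begin
    sumTo (conv f g) (suc n)                                        ≡⟨ sumTo-shift (conv f g) n ⟩
    f 0 * g 0 + sumTo (conv f g ∘ suc) n                            ≡⟨ cong ((f 0 * g 0) +_) (sumTo-linear (f 0) (g ∘ suc) (conv (f ∘ suc) g) n) ⟩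
    f 0 * g 0 + (f 0 * sumTo (g ∘ suc) n + R)                       ≡⟨ solve 4 (λ a b c r → a :* b :+ (a :* c :+ r) := a :* (b :+ c) :+ r) refl (f 0) (g 0) (sumTo (g ∘ suc) n) R ⟩
    f 0 * (g 0 + sumTo (g ∘ suc) n) + R                             ≡⟨ cong (λ z → f 0 * z + R) (sym (sumTo-shift g n)) ⟩
    f 0 * sumTo g (suc n) + R                                       ∎
    where
    open ≡-Reasoning
    open +-*-Solver
    R = sumTo (conv (f ∘ suc) g) n

  conv-cong : ∀ {f f′ g g′} → (∀ i → f i ≡ f′ i) → (∀ i → g i ≡ g′ i) → ∀ n → conv f g n ≡ conv f′ g′ n
  conv-cong f≗ g≗ zero    = cong₂ _*_ (f≗ 0) (g≗ 0)
  conv-cong f≗ g≗ (suc n) = cong₂ _+_ (cong₂ _*_ (f≗ 0) (g≗ (suc n))) (conv-cong (f≗ ∘ suc) g≗ n)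

  conv-last : ∀ f g n → conv f g (suc n) ≡ conv f (g ∘ suc) n + f (suc n) * g 0
  conv-last f g zero    = refl
  conv-last f g (suc n) = trans (cong ((f 0 * g (suc (suc n))) +_) (conv-last (f ∘ suc) g n))
    (sym (+-assoc (f 0 * g (suc (suc n))) (conv (f ∘ suc) (g ∘ suc) n) _))

  conv-+ˡ : ∀ f f′ g n → conv (λ i → f i + f′ i) g n ≡ conv f g n + conv f′ g n
  conv-+ˡ f f′ g zero    = *-distribʳ-+ (g 0) (f 0) (f′ 0)
  conv-+ˡ f f′ g (suc n) = trans (cong (((f 0 + f′ 0) * g (suc n)) +_) (conv-+ˡ (f ∘ suc) (f′ ∘ suc) g n))
    (solve 5 (λ a b x y z → (a :+ b) :* x :+ (y :+ z) := a :* x :+ y :+ (b :* x :+ z)) refl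
      (f 0) (f′ 0) (g (suc n)) (conv (f ∘ suc) g n) (conv (f′ ∘ suc) g n))
    where open +-*-Solver

  conv-*ˡ : ∀ c f g n → conv (λ i → c * f i) g n ≡ c * conv f g n
  conv-*ˡ c f g zero    = *-assoc c (f 0) (g 0)
  conv-*ˡ c f g (suc n) = trans (cong ((c * f 0 * g (suc n)) +_) (conv-*ˡ c (f ∘ suc) g n))
    (solve 4 (λ c a x y → c :* a :* x :+ c :* y := c :* (a :* x :+ y)) refl c (f 0) (g (suc n)) (conv (f ∘ suc) g n))
    where open +-*-Solver

  conv-*ʳ : ∀ c f g n → conv f (λ i → c * g i) n ≡ c * conv f g n
  conv-*ʳ c f g zero    = solve 3 (λ c a b → a :* (c :* b) := c :* (a :* b)) refl c (f 0) (g 0)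
    where open +-*-Solver
  conv-*ʳ c f g (suc n) = trans (cong ((f 0 * (c * g (suc n))) +_) (conv-*ʳ c (f ∘ suc) g n))
    (solve 4 (λ c a x y → a :* (c :* x) :+ c :* y := c :* (a :* x :+ y)) refl c (f 0) (g (suc n)) (conv (f ∘ suc) g n))
    where open +-*-Solver

  -- The operator x d/dx acting on coefficients of power series; `leibniz` is its product rule.
  δ : (ℕ → ℚ) → ℕ → ℚ
  δ f i = ι i * f i

  leibniz : ∀ f g n → ι n * conv f g n ≡ conv (δ f) g n + conv f (δ g) n
  leibniz f g zero = solve 2 (λ a b → con 0ℚ :* (a :* b) := con 0ℚ :* a :* b :+ a :* (con 0ℚ :* b)) refl (f 0) (g 0)
    where open +-*-Solver
  leibniz f g (suc n) = begin
    ι (suc n) * (f 0 * g (suc n) + C)                 ≡⟨ solve 3 (λ s x c → s :* (x :+ c) := s :* x :+ s :* c) refl (ι (suc n)) (f 0 * g (suc n)) C ⟩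
    ι (suc n) * (f 0 * g (suc n)) + ι (suc n) * C     ≡⟨ cong (λ s → ι (suc n) * (f 0 * g (suc n)) + s * C) (ι-suc n) ⟩
    ι (suc n) * (f 0 * g (suc n)) + (1ℚ + ι n) * C    ≡⟨ cong (λ z → ι (suc n) * (f 0 * g (suc n)) + z) (trans (*-distribʳ-+ C 1ℚ (ι n)) (cong₂ _+_ (*-identityˡ C) (leibniz (f ∘ suc) g n))) ⟩
    ι (suc n) * (f 0 * g (suc n)) + (C + (A + B))     ≡⟨ solve 6 (λ s f g c a b → s :* (f :* g) :+ (c :+ (a :+ b)) := con 0ℚ :* f :* g :+ (c :+ a) :+ (f :* (s :* g) :+ b)) refl (ι (suc n)) (f 0) (g (suc n)) C A B ⟩
    0ℚ * f 0 * g (suc n) + (C + A) + (f 0 * (ι (suc n) * g (suc n)) + B)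
      ≡⟨ cong (λ z → 0ℚ * f 0 * g (suc n) + z + (f 0 * (ι (suc n) * g (suc n)) + B)) (sym δ-shift) ⟩
    conv (δ f) g (suc n) + conv f (δ g) (suc n)       ∎
    where
    open ≡-Reasoning
    open +-*-Solver
    C = conv (f ∘ suc) g n
    A = conv (δ (f ∘ suc)) g n
    B = conv (f ∘ suc) (δ g) n
    δ-shift : conv (δ f ∘ suc) g n ≡ C + A
    δ-shift = trans
      (conv-cong (λ i → trans (cong (_* f (suc i)) (ι-suc i)) (trans (*-distribʳ-+ (f (suc i)) 1ℚ (ι i)) (cong (_+ ι i * f (suc i)) (*-identityˡ (f (suc i)))))) (λ _ → refl) n)
      (conv-+ˡ (f ∘ suc) (δ (f ∘ suc)) g n)

  δ-expTerm : ∀ a i → δ (expTerm a) (suc i) ≡ a * expTerm a i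
  δ-expTerm a i = begin
    ι (suc i) * expTerm a (suc i)               ≡⟨ cong (ι (suc i) *_) (expTerm-suc a i) ⟩
    ι (suc i) * (expTerm a i * (a * recip i))   ≡⟨ solve 4 (λ s e a r → s :* (e :* (a :* r)) := s :* r :* (a :* e)) refl (ι (suc i)) (expTerm a i) a (recip i) ⟩
    ι (suc i) * recip i * (a * expTerm a i)     ≡⟨ cong (_* (a * expTerm a i)) (ι-suc-recip i) ⟩
    1ℚ * (a * expTerm a i)                      ≡⟨ *-identityˡ _ ⟩
    a * expTerm a i                             ∎
    where
    open ≡-Reasoning
    open +-*-Solver

  -- Both sides start at 1 and satisfy `(n + 1) c (n + 1) = (a + b) c n`, the left one by `leibniz`
  -- and `δ-expTerm`. This takes the place of the binomial theorem.
  conv-expTerm : ∀ a b n → conv (expTerm a) (expTerm b) n ≡ expTerm (a + b) n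
  conv-expTerm a b zero    = refl
  conv-expTerm a b (suc n) = cancel (begin
    ι (suc n) * conv ea eb (suc n)                    ≡⟨ leibniz ea eb (suc n) ⟩
    conv (δ ea) eb (suc n) + conv ea (δ eb) (suc n)   ≡⟨ cong₂ _+_ left right ⟩
    a * conv ea eb n + b * conv ea eb n               ≡⟨ sym (*-distribʳ-+ (conv ea eb n) a b) ⟩
    (a + b) * conv ea eb n                            ≡⟨ cong ((a + b) *_) (conv-expTerm a b n) ⟩
    (a + b) * expTerm (a + b) n                       ≡⟨ sym (δ-expTerm (a + b) n) ⟩
    ι (suc n) * expTerm (a + b) (suc n)               ∎)
    where
    open ≡-Reasoning
    open +-*-Solver
    ea = expTerm a
    eb = expTerm b
    left : conv (δ ea) eb (suc n) ≡ a * conv ea eb n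
    left = begin
      0ℚ * ea 0 * eb (suc n) + conv (δ ea ∘ suc) eb n   ≡⟨ cong₂ _+_ (*-zeroˡ (eb (suc n))) (trans (conv-cong (δ-expTerm a) (λ _ → refl) n) (conv-*ˡ a ea eb n)) ⟩
      0ℚ + a * conv ea eb n                             ≡⟨ +-identityˡ _ ⟩
      a * conv ea eb n                                  ∎
    right : conv ea (δ eb) (suc n) ≡ b * conv ea eb n
    right = begin
      conv ea (δ eb) (suc n)                            ≡⟨ conv-last ea (δ eb) n ⟩
      conv ea (δ eb ∘ suc) n + ea (suc n) * 0ℚ          ≡⟨ cong₂ _+_ (trans (conv-cong {f = ea} (λ _ → refl) (δ-expTerm b) n) (conv-*ʳ b ea eb n)) (*-zeroʳ (ea (suc n))) ⟩
      b * conv ea eb n + 0ℚ                             ≡⟨ +-identityʳ _ ⟩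
      b * conv ea eb n                                  ∎
    cancel : ∀ {x y} → ι (suc n) * x ≡ ι (suc n) * y → x ≡ y
    cancel {x} {y} eq = trans (expand x) (trans (cong (recip n *_) eq) (sym (expand y)))
      where
      expand : ∀ z → z ≡ recip n * (ι (suc n) * z)
      expand z = begin
        z                             ≡⟨ sym (*-identityˡ z) ⟩
        1ℚ * z                        ≡⟨ cong (_* z) (sym (ι-suc-recip n)) ⟩
        ι (suc n) * recip n * z       ≡⟨ solve 3 (λ s r z → s :* r :* z := r :* (s :* z)) refl (ι (suc n)) (recip n) z ⟩
        recip n * (ι (suc n) * z)     ∎

  -- The sum of `f i * g j` over the corner `i + j > n` of the square `i, j ≤ n`.
  remainder : (ℕ → ℚ) → (ℕ → ℚ) → ℕ → ℚ
  remainder f g n = sumTo f n * sumTo g n - sumTo (conv f g) n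

  -- Row `i = 0` does not meet the corner, and in the other rows column `n + 1` lies entirely inside
  -- it.
  remainder-suc : ∀ f g n → remainder f g (suc n) ≡ remainder (f ∘ suc) g n + sumTo (f ∘ suc) n * g (suc n)
  remainder-suc f g n = begin
    sumTo f (suc n) * sumTo g (suc n) - sumTo (conv f g) (suc n)  ≡⟨ cong₂ (λ x y → x * sumTo g (suc n) - y) (sumTo-shift f n) (sumTo-conv f g n) ⟩
    (f 0 + F) * (G + g′) - (f 0 * (G + g′) + R)                   ≡⟨ solve 5 (λ a f g h r → (a :+ f) :* (g :+ h) :- (a :* (g :+ h) :+ r) := f :* g :- r :+ f :* h) refl (f 0) F G g′ R ⟩
    F * G - R + F * g′                                            ∎
    where
    open ≡-Reasoning
    open +-*-Solver
    F = sumTo (f ∘ suc) n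
    G = sumTo g n
    g′ = g (suc n)
    R = sumTo (conv (f ∘ suc) g) n

  ∣sumTo∣≤ : ∀ {f F} → (∀ i → ∣ f i ∣ ≤ F i) → ∀ n → ∣ sumTo f n ∣ ≤ sumTo F n
  ∣sumTo∣≤ f≤F zero    = f≤F 0
  ∣sumTo∣≤ {f} f≤F (suc n) = ≤-trans (∣p+q∣≤∣p∣+∣q∣ (sumTo f n) (f (suc n))) (+-mono-≤ (∣sumTo∣≤ f≤F n) (f≤F (suc n)))

  -- Despite the minus sign in its definition, `remainder` is a sum of products; `remainder-suc`
  -- exposes this, so absolute values pass to the individual terms.
  remainder-dominated : ∀ {f F g G} → (∀ i → ∣ f i ∣ ≤ F i) → (∀ i → ∣ g i ∣ ≤ G i) →
    ∀ n → ∣ remainder f g n ∣ ≤ remainder F G n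
  remainder-dominated {f} {F} {g} {G} f≤F g≤G zero = ≤-reflexive (trans
    (cong ∣_∣ (+-inverseʳ (f 0 * g 0))) (sym (+-inverseʳ (F 0 * G 0))))
  remainder-dominated {f} {F} {g} {G} f≤F g≤G (suc n) = begin
    ∣ remainder f g (suc n) ∣                                              ≡⟨ cong ∣_∣ (remainder-suc f g n) ⟩
    ∣ remainder (f ∘ suc) g n + sumTo (f ∘ suc) n * g (suc n) ∣            ≤⟨ ∣p+q∣≤∣p∣+∣q∣ (remainder (f ∘ suc) g n) _ ⟩
    ∣ remainder (f ∘ suc) g n ∣ + ∣ sumTo (f ∘ suc) n * g (suc n) ∣        ≡⟨ cong (λ z → ∣ remainder (f ∘ suc) g n ∣ + z) (∣p*q∣≡∣p∣*∣q∣ (sumTo (f ∘ suc) n) (g (suc n))) ⟩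
    ∣ remainder (f ∘ suc) g n ∣ + ∣ sumTo (f ∘ suc) n ∣ * ∣ g (suc n) ∣    ≤⟨ +-mono-≤ (remainder-dominated (f≤F ∘ suc) g≤G n)
                                                                              (*-mono-≤ (0≤∣p∣ (sumTo (f ∘ suc) n)) (∣sumTo∣≤ (f≤F ∘ suc) n) (0≤∣p∣ (g (suc n))) (g≤G (suc n))) ⟩
    remainder (F ∘ suc) G n + sumTo (F ∘ suc) n * G (suc n)                ≡⟨ sym (remainder-suc F G n) ⟩
    remainder F G (suc n)                                                  ∎
    where open ≤-Reasoning

  conv-head : ∀ {f g} → (∀ i → 0ℚ ≤ f i) → (∀ i → 0ℚ ≤ g i) → ∀ n → f 0 * g n ≤ conv f g n
  conv-nonNeg : ∀ {f g} → (∀ i → 0ℚ ≤ f i) → (∀ i → 0ℚ ≤ g i) → ∀ n → 0ℚ ≤ conv f g n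
  conv-head 0≤f 0≤g zero    = ≤-refl
  conv-head 0≤f 0≤g (suc n) = p≤p+q _ (conv-nonNeg (0≤f ∘ suc) 0≤g n)
  conv-nonNeg 0≤f 0≤g n = ≤-trans (*-nonNeg (0≤f 0) (0≤g n)) (conv-head 0≤f 0≤g n)

  -- The rectangle `i ≤ p`, `j ≤ q` lies in the triangle `i + j ≤ p + q`, and all terms are
  -- nonnegative.
  sumTo-*-≤ : ∀ {f g} → (∀ i → 0ℚ ≤ f i) → (∀ i → 0ℚ ≤ g i) → ∀ p q →
    sumTo f p * sumTo g q ≤ sumTo (conv f g) (p ℕ.+ q)
  sumTo-*-≤ {f} {g} 0≤f 0≤g zero q = ≤-trans (≤-reflexive (sym (trans
      (sumTo-linear (f 0) g (λ _ → 0ℚ) q) (trans (cong ((f 0 * sumTo g q) +_) (zeros q)) (+-identityʳ _)))))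
      (sumTo-mono (λ i → ≤-trans (≤-reflexive (+-identityʳ _)) (conv-head 0≤f 0≤g i)) q)
    where
    zeros : ∀ n → sumTo (λ _ → 0ℚ) n ≡ 0ℚ
    zeros zero    = refl
    zeros (suc n) = cong (_+ 0ℚ) (zeros n)
  sumTo-*-≤ {f} {g} 0≤f 0≤g (suc p) q = begin
    sumTo f (suc p) * sumTo g q                              ≡⟨ cong (_* sumTo g q) (sumTo-shift f p) ⟩
    (f 0 + sumTo (f ∘ suc) p) * sumTo g q                    ≡⟨ *-distribʳ-+ (sumTo g q) (f 0) _ ⟩
    f 0 * sumTo g q + sumTo (f ∘ suc) p * sumTo g q          ≤⟨ +-mono-≤ (*-mono-≤ (0≤f 0) ≤-refl (sumTo-nonNeg 0≤g q) (sumTo-extend 0≤g (suc p) q))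
                                                                  (sumTo-*-≤ (0≤f ∘ suc) 0≤g p q) ⟩
    f 0 * sumTo g (suc (p ℕ.+ q)) + sumTo (conv (f ∘ suc) g) (p ℕ.+ q)   ≡⟨ sym (sumTo-conv f g (p ℕ.+ q)) ⟩
    sumTo (conv f g) (suc p ℕ.+ q)                           ∎
    where open ≤-Reasoning

  -- Partial sums of the exponential series

  expSum-sumTo : ∀ q n → expSum q n ≡ sumTo (expTerm q) n
  expSum-sumTo q zero    = refl
  expSum-sumTo q (suc n) = cong (_+ expTerm q (suc n)) (expSum-sumTo q n)

  sumTo-conv-expTerm : ∀ a b n → sumTo (conv (expTerm a) (expTerm b)) n ≡ expSum (a + b) n
  sumTo-conv-expTerm a b n = trans (sumTo-cong (conv-expTerm a b) n) (sym (expSum-sumTo (a + b) n))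

  expTerm-nonNeg : ∀ {q} → 0ℚ ≤ q → ∀ i → 0ℚ ≤ expTerm q i
  expTerm-nonNeg {q} 0≤q = Bounded.0≤T q 0≤q

  expSum-nonNeg : ∀ {q} → 0ℚ ≤ q → ∀ n → 0ℚ ≤ expSum q n
  expSum-nonNeg {q} 0≤q n = subst (0ℚ ≤_) (sym (expSum-sumTo q n)) (sumTo-nonNeg (expTerm-nonNeg 0≤q) n)

  expSum-extend : ∀ {q} → 0ℚ ≤ q → ∀ p n → expSum q n ≤ expSum q (p ℕ.+ n)
  expSum-extend {q} 0≤q p n = subst₂ _≤_ (sym (expSum-sumTo q n)) (sym (expSum-sumTo q (p ℕ.+ n)))
    (sumTo-extend (expTerm-nonNeg 0≤q) p n)

  1≤expSum : ∀ {q} → 0ℚ ≤ q → ∀ n → 1ℚ ≤ expSum q n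
  1≤expSum {q} 0≤q n = subst (λ j → 1ℚ ≤ expSum q j) (ℕ.+-identityʳ n) (expSum-extend 0≤q n 0)

  expTerm-mono : ∀ {p q} → 0ℚ ≤ p → p ≤ q → ∀ i → expTerm p i ≤ expTerm q i
  expTerm-mono {p} {q} 0≤p p≤q i = ≤-trans (p≤∣p∣ (expTerm p i))
    (Bounded.∣term∣≤T q (≤-trans 0≤p p≤q) p (subst (_≤ q) (sym (0≤p⇒∣p∣≡p 0≤p)) p≤q) i)

  expSum-mono : ∀ {p q} → 0ℚ ≤ p → p ≤ q → ∀ n → expSum p n ≤ expSum q n
  expSum-mono {p} {q} 0≤p p≤q n = subst₂ _≤_ (sym (expSum-sumTo p n)) (sym (expSum-sumTo q n))
    (sumTo-mono (expTerm-mono 0≤p p≤q) n)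

  -- The gap is a `remainder` of nonnegative sequences. It is nonnegative because, by
  -- `remainder-dominated` with each sequence dominating itself, it bounds an absolute value.
  expSum-+-≤ : ∀ {a b} → 0ℚ ≤ a → 0ℚ ≤ b → ∀ n → expSum (a + b) n ≤ expSum a n * expSum b n
  expSum-+-≤ {a} {b} 0≤a 0≤b n = begin
    expSum (a + b) n                                                ≡⟨ sym (+-identityʳ _) ⟩
    expSum (a + b) n + 0ℚ                                           ≤⟨ +-monoʳ-≤ (expSum (a + b) n) 0≤R ⟩
    expSum (a + b) n + remainder (expTerm a) (expTerm b) n          ≡⟨ cong (_+ remainder (expTerm a) (expTerm b) n) (sym (sumTo-conv-expTerm a b n)) ⟩
    C + (A * B - C)                                                 ≡⟨ solve 2 (λ c x → c :+ (x :- c) := x) refl C (A * B) ⟩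
    A * B                                                           ≡⟨ sym (cong₂ _*_ (expSum-sumTo a n) (expSum-sumTo b n)) ⟩
    expSum a n * expSum b n                                         ∎
    where
    open ≤-Reasoning
    open +-*-Solver
    A = sumTo (expTerm a) n
    B = sumTo (expTerm b) n
    C = sumTo (conv (expTerm a) (expTerm b)) n
    self : ∀ {q} → 0ℚ ≤ q → ∀ i → ∣ expTerm q i ∣ ≤ expTerm q i
    self 0≤q i = ≤-reflexive (0≤p⇒∣p∣≡p (expTerm-nonNeg 0≤q i))
    0≤R : 0ℚ ≤ remainder (expTerm a) (expTerm b) n
    0≤R = ≤-trans (0≤∣p∣ (remainder (expTerm a) (expTerm b) n)) (remainder-dominated (self 0≤a) (self 0≤b) n)

  expSum-*-≤ : ∀ {a b} → 0ℚ ≤ a → 0ℚ ≤ b → ∀ n → expSum a n * expSum b n ≤ expSum (a + b) (n ℕ.+ n)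
  expSum-*-≤ {a} {b} 0≤a 0≤b n = subst₂ _≤_
    (sym (cong₂ _*_ (expSum-sumTo a n) (expSum-sumTo b n))) (sumTo-conv-expTerm a b (n ℕ.+ n))
    (sumTo-*-≤ (expTerm-nonNeg 0≤a) (expTerm-nonNeg 0≤b) n n)

  expSum-0 : ∀ n → expSum 0ℚ n ≡ 1ℚ
  expSum-0 zero    = refl
  expSum-0 (suc n) = cong₂ _+_ (expSum-0 n)
    (trans (expTerm-suc 0ℚ n) (trans (cong (expTerm 0ℚ n *_) (*-zeroˡ (recip n))) (*-zeroʳ (expTerm 0ℚ n))))

  expSum-multiple : ∀ {x} → 0ℚ ≤ x → ∀ j n → expSum (ι j * x) n ≤ expSum x n ^ j
  expSum-multiple {x} 0≤x zero    n = ≤-reflexive (trans (cong (λ z → expSum z n) (*-zeroˡ x)) (expSum-0 n))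
  expSum-multiple {x} 0≤x (suc j) n = begin
    expSum (ι (suc j) * x) n             ≡⟨ cong (λ z → expSum z n) (trans (cong (_* x) (ι-suc j)) (trans (*-distribʳ-+ x 1ℚ (ι j)) (cong (_+ ι j * x) (*-identityˡ x)))) ⟩
    expSum (x + ι j * x) n               ≤⟨ expSum-+-≤ 0≤x (*-nonNeg (0≤ι j) 0≤x) n ⟩
    expSum x n * expSum (ι j * x) n      ≤⟨ *-mono-≤ (expSum-nonNeg 0≤x n) ≤-refl (expSum-nonNeg (*-nonNeg (0≤ι j) 0≤x) n) (expSum-multiple 0≤x j n) ⟩
    expSum x n * expSum x n ^ j          ∎
    where open ≤-Reasoning

  -- From index 1 on the terms at least halve, so the partial sum plus its last term does not
  -- increase and stays at most 3. The bound 4 makes `4 ^ u` a power of 2.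
  expSum-1 : ∀ n → expSum 1ℚ n ≤ ι 4
  expSum-1 n = ≤-trans (p≤p+q _ (expTerm-nonNeg 0≤1 n)) (≤-trans (three n) (ι-mono-≤ (ℕ.n≤1+n 3)))
    where
    open ≤-Reasoning
    open +-*-Solver
    0≤1 : 0ℚ ≤ 1ℚ
    0≤1 = nonNegative⁻¹ 1ℚ
    e = expTerm 1ℚ
    three : ∀ n → expSum 1ℚ n + e n ≤ ι 3
    three zero          = ι-mono-≤ {2} {3} (ℕ.n≤1+n 2)
    three (suc zero)    = ≤-refl
    three (suc (suc n)) = begin
      expSum 1ℚ (suc n) + e (suc (suc n)) + e (suc (suc n))      ≡⟨ +-assoc (expSum 1ℚ (suc n)) _ _ ⟩
      expSum 1ℚ (suc n) + (e (suc (suc n)) + e (suc (suc n)))    ≤⟨ +-monoʳ-≤ (expSum 1ℚ (suc n)) (+-mono-≤ halves halves) ⟩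
      expSum 1ℚ (suc n) + (e (suc n) * ½ + e (suc n) * ½)        ≡⟨ cong (expSum 1ℚ (suc n) +_) (trans (sym (*-distribˡ-+ (e (suc n)) ½ ½)) (*-identityʳ _)) ⟩
      expSum 1ℚ (suc n) + e (suc n)                              ≤⟨ three (suc n) ⟩
      ι 3                                                        ∎
      where
      halves : e (suc (suc n)) ≤ e (suc n) * ½
      halves = ≤-trans (≤-reflexive (trans (expTerm-suc 1ℚ (suc n)) (cong (e (suc n) *_) (*-identityˡ (recip (suc n))))))
        (*-mono-≤ (expTerm-nonNeg 0≤1 (suc n)) ≤-refl (0≤recip (suc n)) (recip-anti {1} {suc n} (ℕ.s≤s ℕ.z≤n)))

  expSum-≤-4^ : ∀ {x} u → 0ℚ ≤ x → x ≤ ι u → ∀ n → expSum x n ≤ ι (4 ℕ.^ u)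
  expSum-≤-4^ {x} u 0≤x x≤u n = begin
    expSum x n              ≤⟨ expSum-mono 0≤x x≤u n ⟩
    expSum (ι u) n          ≡⟨ cong (λ z → expSum z n) (sym (*-identityʳ (ι u))) ⟩
    expSum (ι u * 1ℚ) n     ≤⟨ expSum-multiple (nonNegative⁻¹ 1ℚ) u n ⟩
    expSum 1ℚ n ^ u         ≤⟨ ^-monoˡ-≤ u (expSum-nonNeg (nonNegative⁻¹ 1ℚ) n) (expSum-1 n) ⟩
    ι 4 ^ u                 ≡⟨ sym (ι-^ 4 u) ⟩
    ι (4 ℕ.^ u)             ∎
    where open ≤-Reasoning

  ^≤!*expSum : ∀ {x} → 0ℚ ≤ x → ∀ t n → t ℕ.≤ n → x ^ t ≤ ι (t !) * expSum x n
  ^≤!*expSum {x} 0≤x t n t≤n = begin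
    x ^ t                     ≡⟨ sym (factorial t) ⟩
    ι (t !) * expTerm x t     ≤⟨ *-mono-≤ (0≤ι (t !)) ≤-refl (expTerm-nonNeg 0≤x t) (term≤ t) ⟩
    ι (t !) * expSum x t      ≤⟨ *-mono-≤ (0≤ι (t !)) ≤-refl (expSum-nonNeg 0≤x t)
                                   (subst (λ j → expSum x t ≤ expSum x j) (ℕ.m∸n+n≡m t≤n) (expSum-extend 0≤x (n ℕ.∸ t) t)) ⟩
    ι (t !) * expSum x n      ∎
    where
    open ≤-Reasoning
    open +-*-Solver
    term≤ : ∀ t → expTerm x t ≤ expSum x t
    term≤ zero    = ≤-refl
    term≤ (suc t) = subst (_≤ expSum x (suc t)) (+-identityˡ _) (+-monoˡ-≤ (expTerm x (suc t)) (expSum-nonNeg 0≤x t))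
    factorial : ∀ t → ι (t !) * expTerm x t ≡ x ^ t
    factorial zero    = refl
    factorial (suc t) = begin-equality
      ι (suc t ℕ.* t !) * expTerm x (suc t)           ≡⟨ cong (_* expTerm x (suc t)) (ι-* (suc t) (t !)) ⟩
      ι (suc t) * ι (t !) * expTerm x (suc t)         ≡⟨ solve 3 (λ s f e → s :* f :* e := f :* (s :* e)) refl (ι (suc t)) (ι (t !)) (expTerm x (suc t)) ⟩
      ι (t !) * (ι (suc t) * expTerm x (suc t))       ≡⟨ cong (ι (t !) *_) (δ-expTerm x t) ⟩
      ι (t !) * (x * expTerm x t)                     ≡⟨ solve 3 (λ f x e → f :* (x :* e) := x :* (f :* e)) refl (ι (t !)) x (expTerm x t) ⟩
      x * (ι (t !) * expTerm x t)                     ≡⟨ cong (x *_) (factorial t) ⟩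
      x * x ^ t                                       ∎

  -- This will exclude negative approximations of logarithms. S_n(-x) S_n(x) differs from S_n(0) = 1
  -- by a remainder dominated by that of S_n(x)², which is at most S_2n(2x) - S_n(2x) and hence at
  -- most 1 far out; moreover S_n(x) ≥ 1.
  expSum-neg-≤2 : ∀ {x} → 0ℚ ≤ x → ∃[ M ] (∀ n → M ℕ.≤ n → expSum (- x) n ≤ ι 2)
  expSum-neg-≤2 {x} 0≤x = M , bound
    where
    open ≤-Reasoning
    open +-*-Solver
    2x = x + x
    0≤2x : 0ℚ ≤ 2x
    0≤2x = +-nonNeg 0≤x 0≤x
    module B = Bounded 2x 0≤2x
    small : ∃[ M ] B.M₀ ℕ.≤ M × B.T M < ½
    small = B.T-small ½ (positive⁻¹ ½)
    M = proj₁ small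
    near : ∀ i → M ℕ.≤ i → ∣ expSum 2x i - expSum 2x M ∣ ≤ ½
    near i M≤i = ≤-trans (B.tail 2x (≤-reflexive (0≤p⇒∣p∣≡p 0≤2x)) (proj₁ (proj₂ small)) M≤i) (<⇒≤ (proj₂ (proj₂ small)))
    module _ (n : ℕ) (M≤n : M ℕ.≤ n) where
      f g : ℕ → ℚ
      f = expTerm (- x)
      g = expTerm x
      f≤g : ∀ i → ∣ f i ∣ ≤ g i
      f≤g = Bounded.∣term∣≤T x 0≤x (- x) (≤-reflexive (trans (∣-p∣≡∣p∣ x) (0≤p⇒∣p∣≡p 0≤x)))
      g≤g : ∀ i → ∣ g i ∣ ≤ g i
      g≤g i = ≤-reflexive (0≤p⇒∣p∣≡p (expTerm-nonNeg 0≤x i))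
      double : expSum 2x (n ℕ.+ n) ≤ expSum 2x n + 1ℚ
      double = begin
        expSum 2x (n ℕ.+ n)          ≤⟨ ∣p-q∣≤⇒p≤q+ (expSum 2x (n ℕ.+ n)) (expSum 2x M) (near (n ℕ.+ n) (ℕ.≤-trans M≤n (ℕ.m≤m+n n n))) ⟩
        expSum 2x M + ½              ≤⟨ +-monoˡ-≤ ½ (∣p-q∣≤⇒p≤q+ (expSum 2x M) (expSum 2x n)
                                          (subst (_≤ ½) (∣p-q∣≡∣q-p∣ (expSum 2x n) (expSum 2x M)) (near n M≤n))) ⟩
        expSum 2x n + ½ + ½          ≡⟨ +-assoc (expSum 2x n) ½ ½ ⟩
        expSum 2x n + 1ℚ             ∎
      remainder≤1 : remainder g g n ≤ 1ℚ
      remainder≤1 = begin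
        sumTo g n * sumTo g n - sumTo (conv g g) n   ≡⟨ cong₂ (λ a c → a * a - c) (sym (expSum-sumTo x n)) (sumTo-conv-expTerm x x n) ⟩
        expSum x n * expSum x n - expSum 2x n        ≤⟨ +-monoˡ-≤ (- expSum 2x n) (≤-trans (expSum-*-≤ 0≤x 0≤x n) double) ⟩
        expSum 2x n + 1ℚ - expSum 2x n               ≡⟨ solve 2 (λ s o → s :+ o :- s := o) refl (expSum 2x n) 1ℚ ⟩
        1ℚ                                           ∎
      total-1 : sumTo (conv f g) n ≡ 1ℚ
      total-1 = trans (sumTo-conv-expTerm (- x) x n) (trans (cong (λ z → expSum z n) (+-inverseˡ x)) (expSum-0 n))
      product≤2 : expSum (- x) n * expSum x n ≤ ι 2
      product≤2 = begin
        expSum (- x) n * expSum x n                             ≡⟨ cong₂ _*_ (expSum-sumTo (- x) n) (expSum-sumTo x n) ⟩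
        sumTo f n * sumTo g n                                   ≡⟨ solve 2 (λ p c → p := c :+ (p :- c)) refl (sumTo f n * sumTo g n) (sumTo (conv f g) n) ⟩
        sumTo (conv f g) n + remainder f g n                    ≤⟨ +-mono-≤ (≤-reflexive total-1)
                                                                     (≤-trans (p≤∣p∣ _) (≤-trans (remainder-dominated f≤g g≤g n) remainder≤1)) ⟩
        1ℚ + 1ℚ                                                 ∎
      bound : expSum (- x) n ≤ ι 2
      bound = ≤-cancel-factor (1≤expSum 0≤x n) (0≤ι 2) product≤2

-- Comparison of the counting bound with the real power.

module Estimates where

  open import Data.Empty using (⊥-elim)
  open import Data.Nat.Base as ℕ using (ℕ; suc; _!)
  import Data.Nat.Properties as ℕ
  import Data.Nat.Solver as ℕ
  open import Data.Product.Base using (_,_; ∃-syntax; proj₁; proj₂)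
  open import Data.Rational.Base
  open import Data.Rational.Properties
  open import Data.Rational.Solver using (module +-*-Solver)
  open import Data.Sum.Base using (inj₁; inj₂)
  open import Relation.Binary.PropositionalEquality
    using (_≡_; refl; sym; trans; cong; cong₂; subst; subst₂)
  import Defs
  open import Defs using (IsVdW; IsReciprocal; power; ℝ; seq; expSum; IsLog; fromℕ; 1ℝ; module RationalLemmas; module ExpLemmas)
  open RationalLemmas using (*-mono-≤; *-nonNeg; bounded)
  open ExpLemmas
  open import Algebra.Definitions.RawSemiring +-*-rawSemiring using (_^_)
  open Exponential
  open Counting using (lossFactor; lossFactor-nonZero; ^-distribʳ-*; module LowerBound)

  -- `IsLog` only speaks of the diagonal sums S_i(z_i). Here the number `j` of terms is freed from
  -- `i`, since products of partial sums need S_2i(z_i). Tails are uniformly small on bounded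
  -- arguments; the error is 1/4 + 1/4 + 1/2.
  log-uniform : ∀ x z → IsLog x z →
    ∃[ N ] (∀ i j → N ℕ.≤ i → i ℕ.≤ j → ∣ expSum (seq z i) j - seq x i ∣ ≤ 1ℚ)
  log-uniform x z isLog =
    let B , 0≤B , N₁ , z≤B = bounded z
        open Bounded B 0≤B
        M , M₀≤M , T<¼ = T-small (½ * ½) (positive⁻¹ (½ * ½))
        N₂ , close = isLog ½ (positive⁻¹ ½)
    in (N₁ ℕ.⊔ N₂) ℕ.⊔ M , λ i j N≤i i≤j →
      let N₁⊔N₂≤i = ℕ.≤-trans (ℕ.m≤m⊔n (N₁ ℕ.⊔ N₂) M) N≤i
          M≤i = ℕ.≤-trans (ℕ.m≤n⊔m (N₁ ℕ.⊔ N₂) M) N≤i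
          q = seq z i
          q≤B = z≤B i (ℕ.≤-trans (ℕ.m≤m⊔n N₁ N₂) N₁⊔N₂≤i)
          near : ∀ j → M ℕ.≤ j → ∣ expSum q j - expSum q M ∣ ≤ ½ * ½
          near j M≤j = ≤-trans (tail q q≤B M₀≤M M≤j) (<⇒≤ T<¼)
      in begin
      ∣ expSum q j - seq x i ∣
        ≡⟨ cong ∣_∣ (split (expSum q j) (expSum q M) (expSum q i) (seq x i)) ⟩
      ∣ (expSum q j - expSum q M) + ((expSum q M - expSum q i) + (expSum q i - seq x i)) ∣
        ≤⟨ ≤-trans (∣p+q∣≤∣p∣+∣q∣ (expSum q j - expSum q M) _)
             (+-monoʳ-≤ ∣ expSum q j - expSum q M ∣ (∣p+q∣≤∣p∣+∣q∣ (expSum q M - expSum q i) (expSum q i - seq x i))) ⟩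
      ∣ expSum q j - expSum q M ∣ + (∣ expSum q M - expSum q i ∣ + ∣ expSum q i - seq x i ∣)
        ≤⟨ +-mono-≤ (near j (ℕ.≤-trans M≤i i≤j)) (+-mono-≤
             (subst (_≤ ½ * ½) (∣p-q∣≡∣q-p∣ (expSum q i) (expSum q M)) (near i M≤i))
             (<⇒≤ (close i (ℕ.≤-trans (ℕ.m≤n⊔m N₁ N₂) N₁⊔N₂≤i)))) ⟩
      1ℚ ∎
    where
    open ≤-Reasoning
    open +-*-Solver
    split : ∀ a b c d → a - d ≡ (a - b) + ((b - c) + (c - d))
    split = solve 4 (λ a b c d → a :- d := (a :- b) :+ ((b :- c) :+ (c :- d))) refl

  ≤-by-contradiction : ∀ {p q} → (q ≤ p → p ≤ q) → p ≤ q
  ≤-by-contradiction {p} {q} f with ≤-total p q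
  ... | inj₁ p≤q = p≤q
  ... | inj₂ q≤p = f q≤p

  +-cancelʳ-≤ : ∀ r {p q} → p + r ≤ q + r → p ≤ q
  +-cancelʳ-≤ r {p} {q} le = subst₂ _≤_ (cancel p r) (cancel q r) (+-monoˡ-≤ (- r) le)
    where
    open +-*-Solver
    cancel : ∀ p r → p + r - r ≡ p
    cancel = solve 2 (λ p r → p :+ r :- r := p) refl

  expSum-nonPos-≤2 : ∀ {q} → q ≤ 0ℚ → ∃[ M ] (∀ n → M ℕ.≤ n → expSum q n ≤ ι 2)
  expSum-nonPos-≤2 {q} q≤0 = subst (λ p → ∃[ M ] (∀ n → M ℕ.≤ n → expSum p n ≤ ι 2))
    (neg-involutive q) (expSum-neg-≤2 (neg-antimono-≤ q≤0))
    where
    open +-*-Solver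
    neg-involutive : ∀ q → - (- q) ≡ q
    neg-involutive = solve 1 (λ q → :- (:- q) := q) refl

  ι-absurd : ∀ {A : Set} {a b} → b ℕ.< a → ι a ≤ ι b → A
  ι-absurd b<a ιa≤ιb = ⊥-elim (ℕ.<⇒≱ b<a (ι-cancel-≤ ιa≤ιb))

  -- Constants depending only on m.

  module Constants (m′ : ℕ) where

    -- With `M = m + 1`, one factor q of `q ^ M` can be spent on bounding `y ^ M` and `q ^ m`
    -- remains. `K` collects the constants in `u ^ m ≤ K * Sb`, and `c₀ * u` bounds the base of the
    -- power in `lossFactor`, using `2 * u + 1 ≤ 3 * u`.
    m M K c₀ : ℕ
    m = suc m′
    M = suc m
    K = 2 ℕ.^ m ℕ.* (2 ℕ.^ M ℕ.* (2 ℕ.* (M ! ℕ.* M !)))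
    c₀ = 2 ℕ.* (3 ℕ.+ (2 ℕ.+ m′) ℕ.* 3)

    -- The 7 yields `6 ≤ q`, enough to force `1 ≤ y`; the product is the multiple of `u ^ m′` to be
    -- absorbed in `loss-≤`.
    threshold : ℕ
    threshold = 7 ℕ.+ K ℕ.* (2 ℕ.^ m ℕ.* (4 ℕ.* m ℕ.* 2 ℕ.^ m ℕ.* c₀ ℕ.^ m′))

    -- The 2 beats the 1 in `k ≤ 1 + 4 ^ u`, so that `k₀ ≤ k` forces `threshold ≤ u`.
    k₀ : ℕ
    k₀ = 4 ℕ.^ threshold ℕ.+ 2

    7≤threshold : 7 ℕ.≤ threshold
    7≤threshold = ℕ.m≤m+n 7 _

    6≤k₀ : 6 ℕ.≤ k₀
    6≤k₀ = ℕ.+-monoˡ-≤ 2 (ℕ.^-monoʳ-≤ 4 {1} {threshold} (ℕ.≤-trans (ℕ.s≤s ℕ.z≤n) 7≤threshold))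

    instance
      K-nonZero : ℕ.NonZero K
      K-nonZero = ℕ.m*n≢0 _ _ {{ℕ.m^n≢0 2 m}} {{ℕ.m*n≢0 _ _ {{ℕ.m^n≢0 2 M}} {{ℕ.m*n≢0 2 _ {{_}} {{ℕ.m*n≢0 _ _ {{M ℕ.!≢0}} {{M ℕ.!≢0}}}}}}}}

    -- `lossFactor` has degree only `m - 1` in `u`, so a single spare factor `u` absorbs all
    -- constants.
    loss-≤ : ∀ u → threshold ℕ.≤ u → K ℕ.* (2 ℕ.^ m ℕ.* lossFactor m′ (2 ℕ.* u ℕ.+ 1)) ℕ.≤ u ℕ.^ m
    loss-≤ u thr≤u = begin
      K ℕ.* (2 ℕ.^ m ℕ.* (A ℕ.* c ℕ.^ m′))              ≤⟨ ℕ.*-monoʳ-≤ K (ℕ.*-monoʳ-≤ (2 ℕ.^ m) (ℕ.*-monoʳ-≤ A (ℕ.^-monoˡ-≤ m′ c≤c₀u))) ⟩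
      K ℕ.* (2 ℕ.^ m ℕ.* (A ℕ.* (c₀ ℕ.* u) ℕ.^ m′))     ≡⟨ cong (λ z → K ℕ.* (2 ℕ.^ m ℕ.* (A ℕ.* z))) (^-distribʳ-* m′ c₀ u) ⟩
      K ℕ.* (2 ℕ.^ m ℕ.* (A ℕ.* (c₀ ℕ.^ m′ ℕ.* u ℕ.^ m′)))
        ≡⟨ solve 5 (λ k p a c u → k :* (p :* (a :* (c :* u))) := k :* (p :* (a :* c)) :* u) refl K (2 ℕ.^ m) A (c₀ ℕ.^ m′) (u ℕ.^ m′) ⟩
      K ℕ.* (2 ℕ.^ m ℕ.* (A ℕ.* c₀ ℕ.^ m′)) ℕ.* u ℕ.^ m′  ≤⟨ ℕ.*-monoˡ-≤ (u ℕ.^ m′) (ℕ.≤-trans (ℕ.m≤n+m _ 7) thr≤u) ⟩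
      u ℕ.* u ℕ.^ m′                                    ∎
      where
      open ℕ.≤-Reasoning
      open ℕ.+-*-Solver
      A = 4 ℕ.* m ℕ.* 2 ℕ.^ m
      c = 2 ℕ.* (3 ℕ.+ (2 ℕ.+ m′) ℕ.* (2 ℕ.* u ℕ.+ 1))
      1≤u : 1 ℕ.≤ u
      1≤u = ℕ.≤-trans (ℕ.s≤s ℕ.z≤n) thr≤u
      c≤c₀u : c ℕ.≤ c₀ ℕ.* u
      c≤c₀u = begin
        2 ℕ.* (3 ℕ.+ (2 ℕ.+ m′) ℕ.* (2 ℕ.* u ℕ.+ 1))        ≤⟨ ℕ.*-monoʳ-≤ 2 (ℕ.+-mono-≤ (ℕ.*-monoʳ-≤ 3 1≤u) (ℕ.*-monoʳ-≤ (2 ℕ.+ m′) (ℕ.+-monoʳ-≤ (2 ℕ.* u) 1≤u))) ⟩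
        2 ℕ.* (3 ℕ.* u ℕ.+ (2 ℕ.+ m′) ℕ.* (2 ℕ.* u ℕ.+ u))  ≡⟨ solve 2 (λ m u → con 2 :* (con 3 :* u :+ (con 2 :+ m) :* (con 2 :* u :+ u)) := con 2 :* (con 3 :+ (con 2 :+ m) :* con 3) :* u) refl m′ u ⟩
        c₀ ℕ.* u                                            ∎

  -- The bound at one index, `q`, `y`, `ρ` standing for log k, log log k and its reciprocal.

  module Estimate (m′ k w i : ℕ) (q y ρ : ℚ)
    (2≤m′ : 2 ℕ.≤ m′) (k₀≤k : Constants.k₀ m′ ℕ.≤ k) (1≤w : 1 ℕ.≤ w) (M≤i : suc (suc m′) ℕ.≤ i)
    (gap : ∀ l → k ℕ.≤ 2 ℕ.^ l → k ℕ.^ m′ ℕ.< w ℕ.* lossFactor m′ l)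
    (exp-q : ∀ j → i ℕ.≤ j → ∣ expSum q j - ι k ∣ ≤ 1ℚ)
    (exp-y : ∀ j → i ℕ.≤ j → ∣ expSum y j - q ∣ ≤ 1ℚ)
    (ρ-y : ∣ ρ * y - 1ℚ ∣ ≤ ½)
    where

    open Constants m′
    open ≤-Reasoning

    ι-+1 : ∀ n → ι n + 1ℚ ≡ ι (suc n)
    ι-+1 n = trans (+-comm (ι n) 1ℚ) (sym (ι-suc n))

    k≤exp-q+1 : ∀ j → i ℕ.≤ j → ι k ≤ expSum q j + 1ℚ
    k≤exp-q+1 j i≤j = ∣p-q∣≤⇒p≤q+ (ι k) (expSum q j) (subst (_≤ 1ℚ) (∣p-q∣≡∣q-p∣ (expSum q j) (ι k)) (exp-q j i≤j))

    q≤exp-y+1 : ∀ j → i ℕ.≤ j → q ≤ expSum y j + 1ℚ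
    q≤exp-y+1 j i≤j = ∣p-q∣≤⇒p≤q+ q (expSum y j) (subst (_≤ 1ℚ) (∣p-q∣≡∣q-p∣ (expSum y j) q) (exp-y j i≤j))

    -- For `q ≤ 0` the partial sums would end up at most 2, yet they stay within 1 of `k ≥ 6` for
    -- all `j ≥ i`.
    0≤q : 0ℚ ≤ q
    0≤q = ≤-by-contradiction λ q≤0 → let N , exp≤2 = expSum-nonPos-≤2 q≤0 in
      ι-absurd (ℕ.<-≤-trans (ℕ.s≤s (ℕ.s≤s (ℕ.s≤s (ℕ.s≤s ℕ.z≤n)))) (ℕ.≤-trans 6≤k₀ k₀≤k))
        (≤-trans (k≤exp-q+1 (i ℕ.⊔ N) (ℕ.m≤m⊔n i N))
          (subst (expSum q (i ℕ.⊔ N) + 1ℚ ≤_) (ι-+1 2) (+-monoˡ-≤ 1ℚ (exp≤2 (i ℕ.⊔ N) (ℕ.m≤n⊔m i N)))))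

    u : ℕ
    u = proj₁ (ceiling-bounds q 0≤q)

    q≤u : q ≤ ι u
    q≤u = proj₁ (proj₂ (ceiling-bounds q 0≤q))

    u≤q+1 : ι u ≤ q + 1ℚ
    u≤q+1 = proj₂ (proj₂ (ceiling-bounds q 0≤q))

    k≤1+4^u : k ℕ.≤ suc (4 ℕ.^ u)
    k≤1+4^u = ι-cancel-≤ (≤-trans (k≤exp-q+1 i ℕ.≤-refl)
      (subst (expSum q i + 1ℚ ≤_) (ι-+1 (4 ℕ.^ u)) (+-monoˡ-≤ 1ℚ (expSum-≤-4^ u 0≤q q≤u i))))

    threshold≤u : threshold ℕ.≤ u
    threshold≤u = ℕ.≮⇒≥ λ u<thr → ℕ.<⇒≱
      (ℕ.<-≤-trans (ℕ.≤-reflexive (ℕ.+-comm 2 (4 ℕ.^ threshold))) (ℕ.≤-trans k₀≤k k≤1+4^u))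
      (ℕ.s≤s (ℕ.^-monoʳ-≤ 4 (ℕ.<⇒≤ u<thr)))

    -- Supplies the `l` of the counting bound: log₂ k is bounded linearly in `u`, hence in `q`.
    k≤2^[2u+1] : k ℕ.≤ 2 ℕ.^ (2 ℕ.* u ℕ.+ 1)
    k≤2^[2u+1] = ℕ.≤-trans k≤1+4^u (ℕ.≤-trans
      (ℕ.+-monoˡ-≤ (4 ℕ.^ u) (ℕ.>-nonZero⁻¹ (4 ℕ.^ u) {{ℕ.m^n≢0 4 u}}))
      (ℕ.≤-reflexive (trans (solve 1 (λ x → x :+ x := x :* con 2) refl (4 ℕ.^ u))
        (trans (cong (ℕ._* 2) (ℕ.^-*-assoc 2 2 u)) (sym (ℕ.^-distribˡ-+-* 2 (2 ℕ.* u) 1))))))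
      where open ℕ.+-*-Solver

    6≤q : ι 6 ≤ q
    6≤q = +-cancelʳ-≤ 1ℚ (≤-trans (ι-mono-≤ (ℕ.≤-trans 7≤threshold threshold≤u)) u≤q+1)

    1≤q : 1ℚ ≤ q
    1≤q = ≤-trans (ι-mono-≤ {1} {6} (ℕ.s≤s ℕ.z≤n)) 6≤q

    0≤y : 0ℚ ≤ y
    0≤y = ≤-by-contradiction λ y≤0 → let N , exp≤2 = expSum-nonPos-≤2 y≤0 in
      ι-absurd {a = 6} {3} (ℕ.m≤m+n 4 2) (≤-trans 6≤q (≤-trans (q≤exp-y+1 (i ℕ.⊔ N) (ℕ.m≤m⊔n i N))
        (+-monoˡ-≤ 1ℚ (exp≤2 (i ℕ.⊔ N) (ℕ.m≤n⊔m i N)))))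

    1≤y : 1ℚ ≤ y
    1≤y = ≤-by-contradiction λ y≤1 → ι-absurd {a = 6} {5} (ℕ.m≤m+n 6 0)
      (≤-trans 6≤q (≤-trans (q≤exp-y+1 i ℕ.≤-refl) (+-monoˡ-≤ 1ℚ (expSum-≤-4^ 1 0≤y y≤1 i))))

    ½≤ρy : ½ ≤ ρ * y
    ½≤ρy = +-cancelʳ-≤ ½ (∣p-q∣≤⇒p≤q+ 1ℚ (ρ * y) (subst (_≤ ½) (∣p-q∣≡∣q-p∣ (ρ * y) 1ℚ) ρ-y))

    0≤ρ : 0ℚ ≤ ρ
    0≤ρ = ≤-by-contradiction λ ρ≤0 → ⊥-elim (<-irrefl refl (<-≤-trans (positive⁻¹ ½) (≤-trans ½≤ρy
      (subst (ρ * y ≤_) (*-zeroˡ y) (*-monoʳ-≤-nonNeg y {{nonNegative 0≤y}} ρ≤0)))))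

    -- From `ρ * y ≤ 3 / 2` and `1 ≤ y`. Here `2 ≤ m′` is used in full, to keep the exponent
    -- `ι m′ - ρ` nonnegative.
    ρ≤m′ : ρ ≤ ι m′
    ρ≤m′ = ≤-trans (≤-cancel-factor 1≤y (nonNegative⁻¹ (1ℚ + ½)) (∣p-q∣≤⇒p≤q+ (ρ * y) 1ℚ ρ-y))
      (≤-trans (+-monoʳ-≤ 1ℚ {½} {1ℚ} (/-mono-≤ {1} {1} {2} {1} (ℕ.s≤s ℕ.z≤n))) (ι-mono-≤ 2≤m′))

    -- The logarithms of the power to be bounded and of the spare factor k^(1 / log log k); they add
    -- up to `ι m′ * q`.
    a b : ℚ
    a = (ι m′ - ρ) * q
    b = ρ * q

    0≤a : 0ℚ ≤ a
    0≤a = *-nonNeg (subst (_≤ ι m′ - ρ) (+-inverseʳ ρ) (+-monoˡ-≤ (- ρ) ρ≤m′)) 0≤q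

    0≤b : 0ℚ ≤ b
    0≤b = *-nonNeg 0≤ρ 0≤q

    Sa Sb : ℚ
    Sa = expSum a i
    Sb = expSum b i

    0≤Sa : 0ℚ ≤ Sa
    0≤Sa = expSum-nonNeg 0≤a i

    -- The product is controlled at index `i + i`, where `exp-q` still applies; its error 1 costs
    -- the factor `2 ^ m′` through `k + 1 ≤ 2 * k`.
    product-bound : Sa * Sb ≤ ι (2 ℕ.^ m′ ℕ.* k ℕ.^ m′)
    product-bound = begin
      Sa * Sb                              ≤⟨ expSum-*-≤ 0≤a 0≤b i ⟩
      expSum (a + b) (i ℕ.+ i)             ≡⟨ cong (λ z → expSum z (i ℕ.+ i)) (solve 3 (λ m r q → (m :- r) :* q :+ r :* q := m :* q) refl (ι m′) ρ q) ⟩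
      expSum (ι m′ * q) (i ℕ.+ i)          ≤⟨ expSum-multiple 0≤q m′ (i ℕ.+ i) ⟩
      expSum q (i ℕ.+ i) ^ m′              ≤⟨ ^-monoˡ-≤ m′ (expSum-nonNeg 0≤q (i ℕ.+ i)) (≤-trans
                                                (∣p-q∣≤⇒p≤q+ (expSum q (i ℕ.+ i)) (ι k) (exp-q (i ℕ.+ i) (ℕ.m≤m+n i i)))
                                                (≤-reflexive (ι-+1 k))) ⟩
      ι (suc k) ^ m′                       ≡⟨ sym (ι-^ (suc k) m′) ⟩
      ι (suc k ℕ.^ m′)                     ≤⟨ ι-mono-≤ (ℕ.^-monoˡ-≤ m′ 1+k≤2k) ⟩
      ι ((2 ℕ.* k) ℕ.^ m′)                 ≡⟨ cong ι (^-distribʳ-* m′ 2 k) ⟩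
      ι (2 ℕ.^ m′ ℕ.* k ℕ.^ m′)            ∎
      where
      open +-*-Solver
      1+k≤2k : suc k ℕ.≤ 2 ℕ.* k
      1+k≤2k = ℕ.≤-trans (ℕ.+-monoˡ-≤ k (ℕ.≤-trans (ℕ.s≤s ℕ.z≤n) (ℕ.≤-trans 6≤k₀ k₀≤k)))
        (ℕ.≤-reflexive (cong (k ℕ.+_) (sym (ℕ.+-identityʳ k))))

    q+1≤2q : q + 1ℚ ≤ ι 2 * q
    q+1≤2q = ≤-trans (+-monoʳ-≤ q 1≤q) (≤-reflexive (trans
      (cong₂ _+_ (sym (*-identityˡ q)) (sym (*-identityˡ q))) (sym (*-distribʳ-+ q 1ℚ 1ℚ))))

    F : ℚ
    F = ι (M !)

    y^M≤ : y ^ M ≤ F * (ι 2 * q)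
    y^M≤ = ≤-trans (^≤!*expSum 0≤y M i M≤i) (*-mono-≤ (0≤ι (M !)) ≤-refl (expSum-nonNeg 0≤y i)
      (≤-trans (∣p-q∣≤⇒p≤q+ (expSum y i) q (exp-y i ℕ.≤-refl)) q+1≤2q))

    1≤2ρy : 1ℚ ≤ ι 2 * (ρ * y)
    1≤2ρy = *-mono-≤ {ι 2} {ι 2} {½} {ρ * y} (0≤ι 2) ≤-refl (nonNegative⁻¹ ½) ½≤ρy

    -- Since 1 ≤ 2 ρ y, q ≤ 2 b y; and y is at most logarithmic in q.

    q^m≤ : q ^ m ≤ ι 2 ^ M * (ι 2 * (F * F)) * Sb
    q^m≤ = *-cancelˡ-≤-pos q {{positive (<-≤-trans (positive⁻¹ 1ℚ) 1≤q)}} (begin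
      q ^ M                                            ≤⟨ ^-monoˡ-≤ M 0≤q (begin
          q                                               ≡⟨ sym (*-identityˡ q) ⟩
          1ℚ * q                                          ≤⟨ *-monoʳ-≤-nonNeg q {{nonNegative 0≤q}} 1≤2ρy ⟩
          ι 2 * (ρ * y) * q                               ≡⟨ solve 4 (λ t r y q → t :* (r :* y) :* q := t :* (r :* q :* y)) refl (ι 2) ρ y q ⟩
          ι 2 * (b * y)                                   ∎) ⟩
      (ι 2 * (b * y)) ^ M                              ≡⟨ trans (*-^ (ι 2) (b * y) M) (cong (ι 2 ^ M *_) (*-^ b y M)) ⟩
      ι 2 ^ M * (b ^ M * y ^ M)                        ≤⟨ *-mono-≤ (^-nonNeg M (0≤ι 2)) ≤-refl (*-nonNeg (^-nonNeg M 0≤b) (^-nonNeg M 0≤y))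
                                                            (*-mono-≤ (^-nonNeg M 0≤b) (^≤!*expSum 0≤b M i M≤i) (^-nonNeg M 0≤y) y^M≤) ⟩
      ι 2 ^ M * (F * Sb * (F * (ι 2 * q)))             ≡⟨ solve 5 (λ p f s t q → p :* (f :* s :* (f :* (t :* q))) := q :* (p :* (t :* (f :* f)) :* s)) refl (ι 2 ^ M) F Sb (ι 2) q ⟩
      q * (ι 2 ^ M * (ι 2 * (F * F)) * Sb)             ∎)
      where open +-*-Solver

    ιK : ι K ≡ ι 2 ^ m * (ι 2 ^ M * (ι 2 * (F * F)))
    ιK = trans (ι-* (2 ℕ.^ m) _) (cong₂ _*_ (ι-^ 2 m) (trans (ι-* (2 ℕ.^ M) _) (cong₂ _*_ (ι-^ 2 M)
      (trans (ι-* 2 (M ! ℕ.* M !)) (cong (ι 2 *_) (ι-* (M !) (M !)))))))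

    u^m≤ : ι (u ℕ.^ m) ≤ ι K * Sb
    u^m≤ = begin
      ι (u ℕ.^ m)                                          ≡⟨ ι-^ u m ⟩
      ι u ^ m                                              ≤⟨ ^-monoˡ-≤ m (0≤ι u) (≤-trans u≤q+1 q+1≤2q) ⟩
      (ι 2 * q) ^ m                                        ≡⟨ *-^ (ι 2) q m ⟩
      ι 2 ^ m * q ^ m                                      ≤⟨ *-mono-≤ (^-nonNeg m (0≤ι 2)) ≤-refl (^-nonNeg m 0≤q) q^m≤ ⟩
      ι 2 ^ m * (ι 2 ^ M * (ι 2 * (F * F)) * Sb)           ≡⟨ sym (*-assoc (ι 2 ^ m) _ Sb) ⟩
      ι 2 ^ m * (ι 2 ^ M * (ι 2 * (F * F))) * Sb           ≡⟨ cong (_* Sb) (sym ιK) ⟩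
      ι K * Sb                                             ∎

    loss G : ℕ
    loss = lossFactor m′ (2 ℕ.* u ℕ.+ 1)
    G = 2 ℕ.^ m′ ℕ.* loss

    ι-positive : ∀ n .{{_ : ℕ.NonZero n}} → Positive (ι n)
    ι-positive n = positive (ι-mono-< {0} {n} (ℕ.>-nonZero⁻¹ n))

    Sb-large : ι (2 ℕ.^ m ℕ.* loss) ≤ Sb
    Sb-large = *-cancelˡ-≤-pos (ι K) {{ι-positive K}} (≤-trans
      (≤-reflexive (sym (ι-* K _))) (≤-trans (ι-mono-≤ (loss-≤ u threshold≤u)) u^m≤))

    -- `Sb` is at least `2 * G`, while `G` alone cancels the loss and the `2 ^ m′` of
    -- `product-bound`; the spare 2 stays with `Sa`.
    2Sa≤w : Sa * ι 2 ≤ ι w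
    2Sa≤w = *-cancelʳ-≤-pos (ι G) {{ι-positive G {{ℕ.m*n≢0 (2 ℕ.^ m′) loss {{ℕ.m^n≢0 2 m′}} {{lossFactor-nonZero m′ (2 ℕ.* u ℕ.+ 1)}}}}}} (begin
      Sa * ι 2 * ι G                      ≡⟨ trans (*-assoc Sa (ι 2) (ι G)) (cong (Sa *_) (trans (sym (ι-* 2 G)) (cong ι (sym (ℕ.*-assoc 2 (2 ℕ.^ m′) loss))))) ⟩
      Sa * ι (2 ℕ.^ m ℕ.* loss)           ≤⟨ *-mono-≤ 0≤Sa ≤-refl (0≤ι (2 ℕ.^ m ℕ.* loss)) Sb-large ⟩
      Sa * Sb                             ≤⟨ product-bound ⟩
      ι (2 ℕ.^ m′ ℕ.* k ℕ.^ m′)           ≤⟨ ι-mono-≤ (ℕ.*-monoʳ-≤ (2 ℕ.^ m′) (ℕ.<⇒≤ (gap (2 ℕ.* u ℕ.+ 1) k≤2^[2u+1]))) ⟩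
      ι (2 ℕ.^ m′ ℕ.* (w ℕ.* loss))       ≡⟨ cong ι (solve 3 (λ p w l → p :* (w :* l) := w :* (p :* l)) refl (2 ℕ.^ m′) w loss) ⟩
      ι (w ℕ.* G)                         ≡⟨ ι-* w G ⟩
      ι w * ι G                           ∎)
      where open ℕ.+-*-Solver

    -- `1 ≤ w` turns the factor 2 of `2Sa≤w` into an additive gap independent of `i`, as the order
    -- on reals requires.
    conclusion : Sa + ½ * ½ < ι w
    conclusion = *-cancelʳ-<-nonNeg (ι 2) (begin-strict
      (Sa + ½ * ½) * ι 2         ≡⟨ *-distribʳ-+ (ι 2) Sa (½ * ½) ⟩
      Sa * ι 2 + ½               ≤⟨ +-monoˡ-≤ ½ 2Sa≤w ⟩
      ι w + ½                    <⟨ +-monoʳ-< (ι w) (<-≤-trans ½<1 (ι-mono-≤ 1≤w)) ⟩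
      ι w + ι w                  ≡⟨ solve 2 (λ w o → w :+ w := w :* con (ι 2)) refl (ι w) 1ℚ ⟩
      ι w * ι 2                  ∎)
      where
      open +-*-Solver
      ½<1 : ½ < 1ℚ
      ½<1 = subst (_< 1ℚ) (+-identityʳ ½) (+-monoʳ-< ½ (positive⁻¹ ½))

  -- Passage to Cauchy reals.

  module Bound (m′ : ℕ) (2≤m′ : 2 ℕ.≤ m′) where
    open Constants m′

    power<vdW : ∀ (k : ℕ) → k₀ ℕ.≤ k → ∀ w → IsVdW k m w →
      ∀ (log-k loglog-k 1/loglog-k : ℝ) → (log≃ : IsLog (fromℕ k) log-k) → IsLog log-k loglog-k → IsReciprocal loglog-k 1/loglog-k →
      power (fromℕ k) log-k log≃ (fromℕ m Defs.- 1ℝ Defs.- 1/loglog-k) Defs.< fromℕ w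
    power<vdW k k₀≤k w (1≤w , unavoidable , _) log-k loglog-k 1/loglog-k log≃ loglog≃ recip≃ =
      let N₁ , exp-log = log-uniform (fromℕ k) log-k log≃
          N₂ , exp-loglog = log-uniform log-k loglog-k loglog≃
          N₃ , product = recip≃ ½ (positive⁻¹ ½)
      in ½ * ½ , positive⁻¹ (½ * ½) , ((N₁ ℕ.⊔ N₂) ℕ.⊔ (N₃ ℕ.⊔ M)) , λ i N≤i →
        let N₁₂≤i = ℕ.m⊔n≤o⇒m≤o (N₁ ℕ.⊔ N₂) (N₃ ℕ.⊔ M) N≤i
            N₃₄≤i = ℕ.m⊔n≤o⇒n≤o (N₁ ℕ.⊔ N₂) (N₃ ℕ.⊔ M) N≤i
            q = seq log-k i
            y = seq loglog-k i
            ρ = seq 1/loglog-k i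
        -- Entry `i` of `power` unfolds to this partial sum; only the exponent `ι m - 1ℚ - ρ` has to
        -- be matched with `ι m′ - ρ`.
        in subst (λ c → expSum (c * q) i + ½ * ½ < ι w) (exponent ρ)
          (Estimate.conclusion m′ k w i q y ρ 2≤m′ k₀≤k 1≤w
            (ℕ.m⊔n≤o⇒n≤o N₃ M N₃₄≤i)
            (λ l k≤2^l → LowerBound.unavoidable-large k m′ w l (ℕ.≤-trans (ℕ.s≤s (ℕ.s≤s ℕ.z≤n)) (ℕ.≤-trans 6≤k₀ k₀≤k))
              (ℕ.≤-trans (ℕ.s≤s ℕ.z≤n) 2≤m′) k≤2^l unavoidable)
            (λ j → exp-log i j (ℕ.m⊔n≤o⇒m≤o N₁ N₂ N₁₂≤i))
            (λ j → exp-loglog i j (ℕ.m⊔n≤o⇒n≤o N₁ N₂ N₁₂≤i))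
            (subst (λ p → ∣ p - 1ℚ ∣ ≤ ½) (*-comm y ρ) (<⇒≤ (product i (ℕ.m⊔n≤o⇒m≤o N₃ M N₃₄≤i)))))
      where
      open +-*-Solver
      exponent : ∀ ρ → ι m′ - ρ ≡ ι m - 1ℚ - ρ
      exponent ρ = trans (solve 3 (λ m o ρ → m :- ρ := o :+ m :- o :- ρ) refl (ι m′) 1ℚ ρ)
        (cong (λ z → z - 1ℚ - ρ) (sym (ι-suc m′)))

open import Defs
open import Data.Nat.Base as ℕ using (ℕ)
open import Data.Product.Base using (∃-syntax; _,_)

theorem2p5 : ∀ (m : ℕ) → 3 ℕ.≤ m →
    ∃[ k₀ ] (∀ (k : ℕ) → 1 ℕ.≤ k → k₀ ℕ.≤ k →
    ∀ (w : ℕ) → IsVdW k m w →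
    ∀ (log-k loglog-k 1/loglog-k : ℝ) →
    (log≃ : IsLog (fromℕ k) log-k) →
    IsLog log-k loglog-k →
    IsReciprocal loglog-k 1/loglog-k →
    power (fromℕ k) log-k log≃ (fromℕ m - 1ℝ - 1/loglog-k) < fromℕ w)
theorem2p5 (ℕ.suc m) (ℕ.s≤s 2≤m) = Estimates.Constants.k₀ m , λ k _ → Estimates.Bound.power<vdW m 2≤m k
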